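{- Let $p\ge 5$ be a prime and let $n\ge 1$ be an integer. Then $$a_0(pn)\equiv a_0(n)\pmod{p^3},$$ where $a_0(n)$ denotes the $n$-th Almkvist–Zudilin number.
   Context: For an integer $n\ge 1$, the Almkvist–Zudilin number $a_0(n)$ is $$a_0(n)=\sum_{k=0}^{\lfloor n/3\rfloor}(-1)^{n-k}\binom{3k}{k}\binom{2k}{k}\binom{n}{3k}\binom{n+k}{k}3^{n-3k}.$$ -}

module Defs where

open import Data.Nat using (ℕ; zero; suc; _∸_; _/_)
import Data.Nat as ℕ
open import Data.Nat.Combinatorics using (_C_)
open import Data.Integer using (ℤ; +_; -1ℤ; _+_; _-_; _*_; _^_)
open import Data.Integer.Divisibility.Signed using (_∣_)

-- The upper limit is inclusive: sum-upto m f = f 0 + … + f m.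
sum-upto : ℕ → (ℕ → ℤ) → ℤ
sum-upto zero    f = f zero
sum-upto (suc m) f = sum-upto m f + f (suc m)

-- The truncated subtractions are exact on the range of summation,
-- since there 3k ≤ n.
a₀-term : ℕ → ℕ → ℤ
a₀-term n k =
  -1ℤ ^ (n ∸ k)
    * + ((3 ℕ.* k) C k)
    * + ((2 ℕ.* k) C k)
    * + (n C (3 ℕ.* k))
    * + ((n ℕ.+ k) C k)
    * (+ 3) ^ (n ∸ 3 ℕ.* k)

-- Almkvist–Zudilin numbers.
a₀ : ℕ → ℤ
a₀ n = sum-upto (n / 3) (a₀-term n)

infix 4 _≡_[mod_]

_≡_[mod_] : ℤ → ℤ → ℤ → Set
x ≡ y [mod m ] = m ∣ x - y

{-# OPTIONS --safe #-}
-- Put W n k = (n+k)! / ((n-3k)! k!⁴), so that a₀ n = Σₖ (-3)ⁿ⁻³ᵏ W n k, and split the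
-- sum for a₀ (p n) according to k = p m + r with 0 ≤ r < p; write M = n - 3m.
-- By Wolstenholme's theorem W (p n) (p m) ≡ W n m (mod p³).  For r > 0 the ratio
-- W (p n) (p m + r) / W (p n) (p m) contains the factor p M, so its other factors
-- matter only mod p², and the ratio is ≡ Q_r(p M) / r!⁴, where
-- Q_r(x) = (x+r)(x+r-1)⋯(x-3r+1) no longer involves m.  Block by block the theorem thus becomes
--     Σ_{r<p} (-27)⁻ʳ Q_r(p M) / r!⁴ ≡ (-3)^(-(p-1)M)   (mod p³).
-- Modulo p³ the left side is a polynomial in p M of degree at most 2, and the right side is
-- uᴹ with u ≡ 1 (mod p), so both are determined by M = 0, 1, 2.  The case M = 0 is trivial.
-- For x = p M with M = 1, 2 one may replace (x+1)⋯(x+r) by (-1)ʳ r!² / ((x-1)⋯(x-r)); this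
-- turns the sum into a balanced, terminating ₃F₂, namely
--     Σ_r 3ˣ⁻³ʳ x (x-r-1)! / ((x-3r)! r!²) = (3/2) (2x choose x),
-- whose right side is ≡ 3ᴹ, again by Wolstenholme's theorem.
module Submission where

open import Defs
import Data.Nat as ℕ
import Data.Nat.DivMod as ℕ
import Data.Nat.Divisibility as ℕ
import Data.Nat.Properties as ℕ
import Data.Nat.Tactic.RingSolver as ℕ-Solver
import Data.Sum as Sum
open import Algebra.Bundles using (module AbelianGroup)
open import Data.Integer using (ℤ; +_; -[1+_]; -_; _+_; _-_; _*_; _^_; 0ℤ; 1ℤ; -1ℤ; NonZero; ∣_∣; ≢-nonZero)
open import Data.Integer.Divisibility.Signed using (_∣_; divides; ∣-trans; ∣⇒∣ᵤ; ∣ᵤ⇒∣; ∣n⇒∣m*n; ∣m⇒∣m*n)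
open import Data.Integer.Properties
open import Data.Integer.Tactic.RingSolver using (solve-∀)
open import Data.Nat using (ℕ; zero; suc; _!)
open import Data.Nat.Combinatorics using (_C_; nCk≡n!/k![n-k]!; k![n∸k]!∣n!; k>n⇒nCk≡0)
open import Data.Nat.Coprimality using (coprime-Bézout; prime⇒coprime)
open import Data.Nat.GCD using (module Bézout)
open import Data.Nat.Primality using (Prime; euclidsLemma; prime⇒irreducible; prime⇒nonZero; prime⇒nonTrivial)
open import Data.Product using (∃-syntax; _,_)
open import Data.Sum using (_⊎_; inj₁; inj₂)
open import Function using (_∘_; _$_)
open import Relation.Binary.Bundles using (Setoid)
open import Relation.Binary.PropositionalEquality hiding ([_])
open import Relation.Nullary using (¬_; yes; no; contradiction)

-- Finite sums and products

-- Why the proof evaluates the inner sum at M = 1, 2 and interpolates: the closed form needs every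
-- nonzero term of the ₃F₂, so 3r ≤ p M has to force r < p, and this stops at M = 2. For M ≥ 3 the
-- block r < p is a proper truncation. The target agrees with this limit: (3/2) (2M choose M) equals
-- 3ᴹ for M = 1 and M = 2 and for no other M (it is 3/2 at 0 and 30 at 3). All arithmetic stays in
-- ℤ. For r < p the fraction 1 / r! becomes the integer (p-1)! / r!, at the price of a common factor
-- (p-1)!⁴, which is prime to p and is cancelled at the end. The negative powers of -3 become powers
-- of an inverse `κ` modulo p³. Quotients of factorials are stated as products, and powers of p are
-- cancelled as exact equalities before any congruence is taken.

∑ : ℕ → (ℕ → ℤ) → ℤ
∑ zero    f = 0ℤ
∑ (suc n) f = ∑ n f + f n

∏ : ℕ → (ℕ → ℤ) → ℤ
∏ zero    f = 1ℤ
∏ (suc n) f = ∏ n f * f n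

∑-cong : ∀ n {f g : ℕ → ℤ} → (∀ i → i ℕ.< n → f i ≡ g i) → ∑ n f ≡ ∑ n g
∑-cong zero    f≡g = refl
∑-cong (suc n) f≡g =
  cong₂ _+_ (∑-cong n λ i i<n → f≡g i (ℕ.m<n⇒m<1+n i<n)) (f≡g n (ℕ.n<1+n n))

∏-cong : ∀ n {f g : ℕ → ℤ} → (∀ i → i ℕ.< n → f i ≡ g i) → ∏ n f ≡ ∏ n g
∏-cong zero    f≡g = refl
∏-cong (suc n) f≡g =
  cong₂ _*_ (∏-cong n λ i i<n → f≡g i (ℕ.m<n⇒m<1+n i<n)) (f≡g n (ℕ.n<1+n n))

∑-*ˡ : ∀ c n (f : ℕ → ℤ) → c * ∑ n f ≡ ∑ n (λ i → c * f i)
∑-*ˡ c zero    f = *-zeroʳ c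
∑-*ˡ c (suc n) f =
  trans (*-distribˡ-+ c (∑ n f) (f n)) (cong (_+ c * f n) (∑-*ˡ c n f))

∑-linear : ∀ a b n (f g : ℕ → ℤ) →
           ∑ n (λ i → a * f i - b * g i) ≡ a * ∑ n f - b * ∑ n g
∑-linear a b zero    f g = sym (cong₂ _-_ (*-zeroʳ a) (*-zeroʳ b))
∑-linear a b (suc n) f g =
  trans (cong (_+ (a * f n - b * g n)) (∑-linear a b n f g))
        (lemma a b (∑ n f) (∑ n g) (f n) (g n))
  where
  lemma : ∀ a b s t x y → a * s - b * t + (a * x - b * y) ≡ a * (s + x) - b * (t + y)
  lemma = solve-∀

∑-telescope : ∀ n (g : ℕ → ℤ) → ∑ n (λ i → g i - g (suc i)) ≡ g 0 - g n
∑-telescope zero    g = sym (+-inverseʳ (g 0))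
∑-telescope (suc n) g =
  trans (cong (_+ (g n - g (suc n))) (∑-telescope n g)) (lemma (g 0) (g n) (g (suc n)))
  where
  lemma : ∀ a b c → a - b + (b - c) ≡ a - c
  lemma = solve-∀

∑-+ : ∀ m n f → ∑ (m ℕ.+ n) f ≡ ∑ m f + ∑ n (λ i → f (m ℕ.+ i))
∑-+ m zero    f rewrite ℕ.+-identityʳ m = sym (+-identityʳ (∑ m f))
∑-+ m (suc n) f rewrite ℕ.+-suc m n =
  trans (cong (_+ f (m ℕ.+ n)) (∑-+ m n f)) (+-assoc (∑ m f) _ _)

∑-blocks : ∀ p m f → ∑ (p ℕ.* m) f ≡ ∑ m (λ i → ∑ p (λ r → f (p ℕ.* i ℕ.+ r)))
∑-blocks p zero    f rewrite ℕ.*-zeroʳ p = refl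
∑-blocks p (suc m) f rewrite ℕ.*-suc p m | ℕ.+-comm p (p ℕ.* m) =
  trans (∑-+ (p ℕ.* m) p f) (cong (_+ ∑ p (λ r → f (p ℕ.* m ℕ.+ r))) (∑-blocks p m f))

∑-zero : ∀ n {f} → (∀ i → i ℕ.< n → f i ≡ 0ℤ) → ∑ n f ≡ 0ℤ
∑-zero zero    f≡0 = refl
∑-zero (suc n) f≡0 =
  cong₂ _+_ (∑-zero n λ i i<n → f≡0 i (ℕ.m<n⇒m<1+n i<n)) (f≡0 n (ℕ.n<1+n n))

∏-* : ∀ n f g → ∏ n (λ i → f i * g i) ≡ ∏ n f * ∏ n g
∏-* zero    f g = refl
∏-* (suc n) f g =
  trans (cong (_* (f n * g n)) (∏-* n f g)) (lemma (∏ n f) (∏ n g) (f n) (g n))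
  where
  lemma : ∀ a b c d → a * b * (c * d) ≡ a * c * (b * d)
  lemma = solve-∀

∏-const : ∀ n c → ∏ n (λ _ → c) ≡ c ^ n
∏-const zero    c = refl
∏-const (suc n) c = trans (cong (_* c) (∏-const n c)) (*-comm (c ^ n) c)

∏-+ : ∀ m n f → ∏ (m ℕ.+ n) f ≡ ∏ m f * ∏ n (λ i → f (m ℕ.+ i))
∏-+ m zero    f rewrite ℕ.+-identityʳ m = sym (*-identityʳ (∏ m f))
∏-+ m (suc n) f rewrite ℕ.+-suc m n =
  trans (cong (_* f (m ℕ.+ n)) (∏-+ m n f)) (*-assoc (∏ m f) _ _)

∏-suc : ∀ n f → ∏ (suc n) f ≡ f 0 * ∏ n (f ∘ suc)
∏-suc n f = trans (∏-+ 1 n f) (cong (_* ∏ n (f ∘ suc)) (*-identityˡ (f 0)))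

-- With `f` defined on ℤ, the reflected index n - 1 - i is an exact subtraction, which the ring
-- solver can simplify.
∏-reverse : ∀ n (f : ℤ → ℤ) → ∏ n (λ i → f (+ i)) ≡ ∏ n (λ i → f (+ n - 1ℤ - + i))
∏-reverse zero    f = refl
∏-reverse (suc n) f = sym (begin
  ∏ (suc n) (λ i → f (+ suc n - 1ℤ - + i))
    ≡⟨ ∏-suc n _ ⟩
  f (+ suc n - 1ℤ - 0ℤ) * ∏ n (λ i → f (+ suc n - 1ℤ - + suc i))
    ≡⟨ cong₂ (λ a b → f a * b) (top (+ n)) (∏-cong n λ i _ → cong f (shift (+ n) (+ i))) ⟩
  f (+ n) * ∏ n (λ i → f (+ n - 1ℤ - + i))
    ≡⟨ cong (f (+ n) *_) (∏-reverse n f) ⟨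
  f (+ n) * ∏ n (λ i → f (+ i))
    ≡⟨ *-comm (f (+ n)) _ ⟩
  ∏ n (λ i → f (+ i)) * f (+ n) ∎)
  where
  open ≡-Reasoning
  top : ∀ n → 1ℤ + n - 1ℤ - 0ℤ ≡ n
  top = solve-∀
  shift : ∀ n i → 1ℤ + n - 1ℤ - (1ℤ + i) ≡ n - 1ℤ - i
  shift = solve-∀

^-distribʳ-* : ∀ n x y → (x * y) ^ n ≡ x ^ n * y ^ n
^-distribʳ-* zero    x y = refl
^-distribʳ-* (suc n) x y =
  trans (cong (x * y *_) (^-distribʳ-* n x y)) (lemma x y (x ^ n) (y ^ n))
  where
  lemma : ∀ a b c d → a * b * (c * d) ≡ a * c * (b * d)
  lemma = solve-∀

^-nonZero : ∀ x n .{{_ : NonZero x}} → NonZero (x ^ n)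
^-nonZero x n = ≢-nonZero λ xⁿ≡0 → ℕ.≢-nonZero⁻¹ ∣ x ∣ (cong ∣_∣ (i^n≡0⇒i≡0 x n xⁿ≡0))

-- Factorials

fac : ℕ → ℤ
fac n = + (n !)

fac-suc : ∀ n → fac (suc n) ≡ + suc n * fac n
fac-suc n = pos-* (suc n) (n !)

fac-nonZero : ∀ n → NonZero (fac n)
fac-nonZero n = ℕ._!≢0 n

fall : ℤ → ℕ → ℤ
fall x k = ∏ k (λ i → x - + i)

-- Starts at x + 1, unlike the usual rising factorial, so that `rise (+ a) r` is (a + r)! / a!.
rise : ℤ → ℕ → ℤ
rise x k = ∏ k (λ i → x + + suc i)

rise-fac : ∀ a r → rise (+ a) r * fac a ≡ fac (a ℕ.+ r)
rise-fac a zero    = trans (*-identityˡ (fac a)) (cong fac (sym (ℕ.+-identityʳ a)))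
rise-fac a (suc r) = begin
  rise (+ a) r * (+ a + + suc r) * fac a    ≡⟨ swap (rise (+ a) r) _ (fac a) ⟩
  + (a ℕ.+ suc r) * (rise (+ a) r * fac a)  ≡⟨ cong (+ (a ℕ.+ suc r) *_) (rise-fac a r) ⟩
  + (a ℕ.+ suc r) * fac (a ℕ.+ r)           ≡⟨ cong (λ n → + n * fac (a ℕ.+ r)) (ℕ.+-suc a r) ⟩
  + suc (a ℕ.+ r) * fac (a ℕ.+ r)           ≡⟨ fac-suc (a ℕ.+ r) ⟨
  fac (suc (a ℕ.+ r))                       ≡⟨ cong fac (ℕ.+-suc a r) ⟨
  fac (a ℕ.+ suc r)                         ∎
  where
  open ≡-Reasoning
  swap : ∀ a b c → a * b * c ≡ b * (a * c)
  swap = solve-∀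

fac≡rise : ∀ r → rise 0ℤ r ≡ fac r
fac≡rise r = trans (sym (*-identityʳ _)) (rise-fac 0 r)

fall-fac : ∀ e k → fall (+ (e ℕ.+ k)) k * fac e ≡ fac (e ℕ.+ k)
fall-fac e zero    = trans (*-identityˡ (fac e)) (cong fac (sym (ℕ.+-identityʳ e)))
fall-fac e (suc k) = begin
  fall (+ (e ℕ.+ suc k)) (suc k) * fac e
    ≡⟨ cong (λ n → fall (+ n) (suc k) * fac e) (ℕ.+-suc e k) ⟩
  fall (+ (suc e ℕ.+ k)) k * (+ (suc e ℕ.+ k) - + k) * fac e
    ≡⟨ cong (λ z → fall (+ (suc e ℕ.+ k)) k * z * fac e) (cancel (+ suc e) (+ k)) ⟩
  fall (+ (suc e ℕ.+ k)) k * + suc e * fac e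
    ≡⟨ *-assoc (fall (+ (suc e ℕ.+ k)) k) _ _ ⟩
  fall (+ (suc e ℕ.+ k)) k * (+ suc e * fac e)
    ≡⟨ cong (fall (+ (suc e ℕ.+ k)) k *_) (fac-suc e) ⟨
  fall (+ (suc e ℕ.+ k)) k * fac (suc e)
    ≡⟨ fall-fac (suc e) k ⟩
  fac (suc e ℕ.+ k)
    ≡⟨ cong fac (ℕ.+-suc e k) ⟨
  fac (e ℕ.+ suc k) ∎
  where
  open ≡-Reasoning
  cancel : ∀ a b → a + b - b ≡ a
  cancel = solve-∀

fall-zero : ∀ e k → e ℕ.< k → fall (+ e) k ≡ 0ℤ
fall-zero e (suc k) e<1+k with ℕ.m≤n⇒m<n∨m≡n (ℕ.s≤s⁻¹ e<1+k)
... | inj₁ e<k  = trans (cong (_* (+ e - + k)) (fall-zero e k e<k)) (*-zeroˡ (+ e - + k))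
... | inj₂ refl = trans (cong (fall (+ e) e *_) (+-inverseʳ (+ e))) (*-zeroʳ (fall (+ e) e))

-- Congruences

infix 4 _≈_⟨mod_⟩

-- A record, unlike _≡_[mod_], lets Agda infer x, y and m.
record _≈_⟨mod_⟩ (x y m : ℤ) : Set where
  constructor by
  field
    quot : ℤ
    eq   : x ≡ y + quot * m

≈⇒∣ : ∀ {x y m} → x ≈ y ⟨mod m ⟩ → m ∣ x - y
≈⇒∣ {y = y} {m} (by q refl) = divides q (lemma y (q * m))
  where
  lemma : ∀ y z → y + z - y ≡ z
  lemma = solve-∀

∣⇒≈ : ∀ {x y m} → m ∣ x - y → x ≈ y ⟨mod m ⟩
∣⇒≈ {x} {y} (divides q eq) = by q (trans (lemma x y) (cong (_+_ y) eq))
  where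
  lemma : ∀ x y → x ≡ y + (x - y)
  lemma = solve-∀

≈-reflexive : ∀ {x y m} → x ≡ y → x ≈ y ⟨mod m ⟩
≈-reflexive {x} {m = m} refl = by 0ℤ (lemma x m)
  where
  lemma : ∀ x m → x ≡ x + 0ℤ * m
  lemma = solve-∀

≈-refl : ∀ {x m} → x ≈ x ⟨mod m ⟩
≈-refl = ≈-reflexive refl

≈-sym : ∀ {x y m} → x ≈ y ⟨mod m ⟩ → y ≈ x ⟨mod m ⟩
≈-sym {y = y} {m} (by q refl) = by (- q) (lemma y q m)
  where
  lemma : ∀ y q m → y ≡ y + q * m + - q * m
  lemma = solve-∀

≈-trans : ∀ {x y z m} → x ≈ y ⟨mod m ⟩ → y ≈ z ⟨mod m ⟩ → x ≈ z ⟨mod m ⟩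
≈-trans {z = z} {m} (by q refl) (by r refl) = by (r + q) (lemma z q r m)
  where
  lemma : ∀ z q r m → z + r * m + q * m ≡ z + (r + q) * m
  lemma = solve-∀

mod-setoid : ℤ → Setoid _ _
mod-setoid m = record
  { Carrier       = ℤ
  ; _≈_           = λ x y → x ≈ y ⟨mod m ⟩
  ; isEquivalence = record { refl = ≈-refl ; sym = ≈-sym ; trans = ≈-trans }
  }

module ≈-Reasoning (m : ℤ) where
  open import Relation.Binary.Reasoning.Setoid (mod-setoid m) public

+-≈ : ∀ {x y u v m} → x ≈ y ⟨mod m ⟩ → u ≈ v ⟨mod m ⟩ → x + u ≈ y + v ⟨mod m ⟩
+-≈ {y = y} {v = v} {m} (by q refl) (by r refl) = by (q + r) (lemma y v q r m)
  where
  lemma : ∀ y v q r m → y + q * m + (v + r * m) ≡ y + v + (q + r) * m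
  lemma = solve-∀

neg-≈ : ∀ {x y m} → x ≈ y ⟨mod m ⟩ → - x ≈ - y ⟨mod m ⟩
neg-≈ {y = y} {m} (by q refl) = by (- q) (lemma y q m)
  where
  lemma : ∀ y q m → - (y + q * m) ≡ - y + - q * m
  lemma = solve-∀

*-≈ : ∀ {x y u v m} → x ≈ y ⟨mod m ⟩ → u ≈ v ⟨mod m ⟩ → x * u ≈ y * v ⟨mod m ⟩
*-≈ {y = y} {v = v} {m} (by q refl) (by r refl) =
  by (y * r + q * v + q * r * m) (lemma y v q r m)
  where
  lemma : ∀ y v q r m → (y + q * m) * (v + r * m) ≡ y * v + (y * r + q * v + q * r * m) * m
  lemma = solve-∀

*-≈ˡ : ∀ c {x y m} → x ≈ y ⟨mod m ⟩ → c * x ≈ c * y ⟨mod m ⟩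
*-≈ˡ c = *-≈ (≈-refl {c})

*-≈ʳ : ∀ c {x y m} → x ≈ y ⟨mod m ⟩ → x * c ≈ y * c ⟨mod m ⟩
*-≈ʳ c x≈y = *-≈ x≈y (≈-refl {c})

^-≈ : ∀ n {x y m} → x ≈ y ⟨mod m ⟩ → x ^ n ≈ y ^ n ⟨mod m ⟩
^-≈ zero    x≈y = ≈-refl
^-≈ (suc n) x≈y = *-≈ x≈y (^-≈ n x≈y)

∑-≈ : ∀ {m} n {f g : ℕ → ℤ} → (∀ i → i ℕ.< n → f i ≈ g i ⟨mod m ⟩) → ∑ n f ≈ ∑ n g ⟨mod m ⟩
∑-≈ zero    f≈g = ≈-refl
∑-≈ (suc n) f≈g =
  +-≈ (∑-≈ n λ i i<n → f≈g i (ℕ.m<n⇒m<1+n i<n)) (f≈g n (ℕ.n<1+n n))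

∏-≈ : ∀ {m} n {f g : ℕ → ℤ} → (∀ i → i ℕ.< n → f i ≈ g i ⟨mod m ⟩) → ∏ n f ≈ ∏ n g ⟨mod m ⟩
∏-≈ zero    f≈g = ≈-refl
∏-≈ (suc n) f≈g =
  *-≈ (∏-≈ n λ i i<n → f≈g i (ℕ.m<n⇒m<1+n i<n)) (f≈g n (ℕ.n<1+n n))

-- The source of the last power of p: with m = P and n = P ^ 2, the modulus m * n is P ^ 3 by
-- definition.
*-≈-scale : ∀ {c x y m n} → m ∣ c → x ≈ y ⟨mod n ⟩ → c * x ≈ c * y ⟨mod m * n ⟩
*-≈-scale {y = y} {m} {n} (divides k refl) (by q refl) = by (k * q) (lemma k m y q n)
  where
  lemma : ∀ k m y q n → k * m * (y + q * n) ≡ k * m * y + k * q * (m * n)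
  lemma = solve-∀

≈-weaken : ∀ {x y m n} → m ∣ n → x ≈ y ⟨mod n ⟩ → x ≈ y ⟨mod m ⟩
≈-weaken {y = y} {m} (divides k refl) (by q refl) = by (q * k) (cong (_+_ y) (sym (*-assoc q k m)))

∣⇒≈0 : ∀ {x m} → m ∣ x → x ≈ 0ℤ ⟨mod m ⟩
∣⇒≈0 (divides q refl) = by q (sym (+-identityˡ _))

≈0⇒∣ : ∀ {x m} → x ≈ 0ℤ ⟨mod m ⟩ → m ∣ x
≈0⇒∣ (by q refl) = divides q (+-identityˡ _)

-- Cancellation modulo a prime power

module Units (p : ℕ) (p-prime : Prime p) where

  P : ℤ
  P = + p

  instance
    P-nonZero : NonZero P
    P-nonZero = prime⇒nonZero p-prime

  Unit : ℤ → Set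
  Unit d = ¬ (P ∣ d)

  euclid : ∀ x y → P ∣ x * y → (P ∣ x) ⊎ (P ∣ y)
  euclid x y P∣xy =
    Sum.map ∣ᵤ⇒∣ ∣ᵤ⇒∣
      (euclidsLemma ∣ x ∣ ∣ y ∣ p-prime (subst (p ℕ.∣_) (abs-* x y) (∣⇒∣ᵤ P∣xy)))

  unit-* : ∀ {x y} → Unit x → Unit y → Unit (x * y)
  unit-* {x} {y} ux uy P∣xy = Sum.[ ux , uy ] (euclid x y P∣xy)

  unit-small : ∀ {j} → 0 ℕ.< j → j ℕ.< p → Unit (+ j)
  unit-small {suc j} _ j<p P∣j = ℕ.<⇒≱ j<p (ℕ.∣⇒≤ (∣⇒∣ᵤ P∣j))

  unit-1 : Unit 1ℤ
  unit-1 P∣1 = ℕ.<⇒≱ (ℕ.nonTrivial⇒n>1 p {{prime⇒nonTrivial p-prime}}) (ℕ.∣⇒≤ (∣⇒∣ᵤ P∣1))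

  unit-^ : ∀ {x} n → Unit x → Unit (x ^ n)
  unit-^ zero    ux = unit-1
  unit-^ (suc n) ux = unit-* ux (unit-^ n ux)

  unit-∏ : ∀ n {f : ℕ → ℤ} → (∀ i → i ℕ.< n → Unit (f i)) → Unit (∏ n f)
  unit-∏ zero    uf = unit-1
  unit-∏ (suc n) uf =
    unit-* (unit-∏ n λ i i<n → uf i (ℕ.m<n⇒m<1+n i<n)) (uf n (ℕ.n<1+n n))

  unit-fac : ∀ r → r ℕ.< p → Unit (fac r)
  unit-fac r r<p = subst Unit (fac≡rise r) $ unit-∏ r λ i i<r →
    subst Unit (sym (+-identityˡ (+ suc i))) (unit-small ℕ.z<s (ℕ.≤-<-trans i<r r<p))

  unit-≈ : ∀ {x y} → x ≈ y ⟨mod P ⟩ → Unit y → Unit x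
  unit-≈ x≈y uy P∣x = uy (≈0⇒∣ (≈-trans (≈-sym x≈y) (∣⇒≈0 P∣x)))

  -- Induction on the exponent: Euclid's lemma places one factor P in x, and dividing both sides by
  -- it leaves the same claim for the smaller exponent.
  unit-cancel-∣ : ∀ {d} x k → Unit d → P ^ k ∣ d * x → P ^ k ∣ x
  unit-cancel-∣ x zero ud _ = divides x (sym (*-identityʳ x))
  unit-cancel-∣ {d} x (suc k) ud (divides q dx≡q)
    with euclid d x (divides (q * P ^ k) (trans dx≡q (lemma q P (P ^ k))))
    where
    lemma : ∀ q a b → q * (a * b) ≡ q * b * a
    lemma = solve-∀
  ... | inj₁ P∣d = contradiction P∣d ud
  ... | inj₂ (divides y refl) with unit-cancel-∣ y k ud (divides q
          (*-cancelʳ-≡ (d * y) (q * P ^ k) P (trans (*-assoc d y P) (trans dx≡q (lemma q P (P ^ k))))))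
    where
    lemma : ∀ q a b → q * (a * b) ≡ q * b * a
    lemma = solve-∀
  ...   | divides r refl = divides r (lemma r (P ^ k) P)
    where
    lemma : ∀ r a b → r * a * b ≡ r * (b * a)
    lemma = solve-∀

  unit-cancel : ∀ {d x y} k → Unit d → d * x ≈ d * y ⟨mod P ^ k ⟩ → x ≈ y ⟨mod P ^ k ⟩
  unit-cancel {d} {x} {y} k ud dx≈dy =
    ∣⇒≈ (unit-cancel-∣ (x - y) k ud (subst (P ^ k ∣_) (lemma d x y) (≈⇒∣ dx≈dy)))
    where
    lemma : ∀ d x y → d * x - d * y ≡ d * (x - y)
    lemma = solve-∀

  unit-cancel₁ : ∀ {d x y} → Unit d → d * x ≈ d * y ⟨mod P ⟩ → x ≈ y ⟨mod P ⟩
  unit-cancel₁ {d} {x} {y} ud dx≈dy =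
    subst (x ≈ y ⟨mod_⟩) (^-identityʳ P)
      (unit-cancel 1 ud (subst (d * x ≈ d * y ⟨mod_⟩) (sym (^-identityʳ P)) dx≈dy))

-- Wolstenholme's theorem

-- The coefficient of z in ∏ᵢ (z + c i).
e₁ : ℕ → (ℕ → ℤ) → ℤ
e₁ zero    c = 0ℤ
e₁ (suc n) c = e₁ n c * c n + ∏ n c

∏-expand : ∀ n c z → ∃[ k ] ∏ n (λ i → z + c i) ≡ ∏ n c + (e₁ n c + k * z) * z
∏-expand zero    c z = 0ℤ , refl
∏-expand (suc n) c z with ∏-expand n c z
... | k , eq = e₁ n c + k * z + k * c n ,
               trans (cong (_* (z + c n)) eq) (lemma (∏ n c) (e₁ n c) k z (c n))
  where
  lemma : ∀ a b k z c → (a + (b + k * z) * z) * (z + c) ≡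
                        a * c + (b * c + a + (b + k * z + k * c) * z) * z
  lemma = solve-∀

-- `e₁ n` is homogeneous of degree n - 1. The extra factor `a` on the left avoids that exponent, so
-- that n = 0 needs no exception.
e₁-scale : ∀ {m} n {c d : ℕ → ℤ} a → (∀ i → d i ≈ a * c i ⟨mod m ⟩) →
           a * e₁ n d ≈ a ^ n * e₁ n c ⟨mod m ⟩
∏-scale : ∀ {m} n {c d : ℕ → ℤ} a → (∀ i → d i ≈ a * c i ⟨mod m ⟩) →
          ∏ n d ≈ a ^ n * ∏ n c ⟨mod m ⟩

∏-scale {m} n {c} {d} a d≈ac = begin
  ∏ n d                   ≈⟨ ∏-≈ n (λ i _ → d≈ac i) ⟩
  ∏ n (λ i → a * c i)     ≡⟨ ∏-* n (λ _ → a) c ⟩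
  ∏ n (λ _ → a) * ∏ n c   ≡⟨ cong (_* ∏ n c) (∏-const n a) ⟩
  a ^ n * ∏ n c           ∎
  where open ≈-Reasoning m

e₁-scale zero    a d≈ac = ≈-reflexive (*-zeroʳ a)
e₁-scale {m} (suc n) {c} {d} a d≈ac = begin
  a * (e₁ n d * d n + ∏ n d)
    ≡⟨ lemma₁ a (e₁ n d) (d n) (∏ n d) ⟩
  a * e₁ n d * d n + a * ∏ n d
    ≈⟨ +-≈ (*-≈ (e₁-scale n a d≈ac) (d≈ac n)) (*-≈ˡ a (∏-scale n a d≈ac)) ⟩
  a ^ n * e₁ n c * (a * c n) + a * (a ^ n * ∏ n c)
    ≡⟨ lemma₂ a (a ^ n) (e₁ n c) (c n) (∏ n c) ⟩
  a * a ^ n * (e₁ n c * c n + ∏ n c) ∎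
  where
  open ≈-Reasoning m
  lemma₁ : ∀ a e d s → a * (e * d + s) ≡ a * e * d + a * s
  lemma₁ = solve-∀
  lemma₂ : ∀ a b e c s → b * e * (a * c) + a * (b * s) ≡ a * b * (e * c + s)
  lemma₂ = solve-∀

module Pairing (h : ℕ) (P : ℤ) (P≡1+2h : P ≡ 1ℤ + (+ h + + h)) where

  c d : ℕ → ℤ
  c i = + suc i * (P - + suc i)
  d i = + 2 * + suc i * (P - + 2 * + suc i)

  -- The factors y + j and y + P - j multiply to y (y + P) + j (P - j). Thus y enters only through y
  -- (y + P), which is divisible by P² when P divides y.
  rise-pair : ∀ y → rise y (h ℕ.+ h) ≡ ∏ h (λ i → y * (y + P) + c i)
  rise-pair y = begin
    rise y (h ℕ.+ h)
      ≡⟨ ∏-+ h h (λ i → y + + suc i) ⟩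
    rise y h * ∏ h (λ i → y + (1ℤ + (+ h + + i)))
      ≡⟨ cong (rise y h *_) (∏-reverse h (λ i → y + (1ℤ + (+ h + i)))) ⟩
    rise y h * ∏ h (λ i → y + (1ℤ + (+ h + (+ h - 1ℤ - + i))))
      ≡⟨ ∏-* h _ _ ⟨
    ∏ h (λ i → (y + + suc i) * (y + (1ℤ + (+ h + (+ h - 1ℤ - + i)))))
      ≡⟨ ∏-cong h (λ i _ → trans (lemma y (+ h) (+ i))
           (cong (λ P → y * (y + P) + + suc i * (P - + suc i)) (sym P≡1+2h))) ⟩
    ∏ h (λ i → y * (y + P) + c i) ∎
    where
    open ≡-Reasoning
    lemma : ∀ y h i → (y + (1ℤ + i)) * (y + (1ℤ + (h + (h - 1ℤ - i)))) ≡
                      y * (y + (1ℤ + (h + h))) + (1ℤ + i) * (1ℤ + (h + h) - (1ℤ + i))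
    lemma = solve-∀

  ∏-even-odd : ∀ n (f : ℤ → ℤ) →
    ∏ (n ℕ.+ n) (λ i → f (+ i)) ≡ ∏ n (λ i → f (+ 2 * + i)) * ∏ n (λ i → f (1ℤ + + 2 * + i))
  ∏-even-odd zero    f = refl
  ∏-even-odd (suc n) f = begin
    ∏ (suc (n ℕ.+ suc n)) g
      ≡⟨ cong (λ m → ∏ (suc m) g) (ℕ.+-suc n n) ⟩
    ∏ (n ℕ.+ n) g * f (+ (n ℕ.+ n)) * f (+ suc (n ℕ.+ n))
      ≡⟨ cong₂ (λ a b → ∏ (n ℕ.+ n) g * f a * f b) (double (+ n)) (cong (_+_ 1ℤ) (double (+ n))) ⟩
    ∏ (n ℕ.+ n) g * f (+ 2 * + n) * f (1ℤ + + 2 * + n)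
      ≡⟨ cong (λ s → s * f (+ 2 * + n) * f (1ℤ + + 2 * + n)) (∏-even-odd n f) ⟩
    ∏ n (λ i → f (+ 2 * + i)) * ∏ n (λ i → f (1ℤ + + 2 * + i)) * f (+ 2 * + n) * f (1ℤ + + 2 * + n)
      ≡⟨ swap (∏ n (λ i → f (+ 2 * + i))) _ _ _ ⟩
    ∏ n (λ i → f (+ 2 * + i)) * f (+ 2 * + n) * (∏ n (λ i → f (1ℤ + + 2 * + i)) * f (1ℤ + + 2 * + n)) ∎
    where
    open ≡-Reasoning
    g : ℕ → ℤ
    g i = f (+ i)
    double : ∀ n → n + n ≡ + 2 * n
    double = solve-∀
    swap : ∀ a b x y → a * b * x * y ≡ a * x * (b * y)
    swap = solve-∀

  -- Here the even number 2j is paired with the odd number P - 2j. The pairs are those of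
  -- `rise-pair` in another order, but in this order `d i` is comparable with 4 times `c i`. This is
  -- the classical substitution j ↦ 2j in the sum of 1 / j², done without permuting a product.
  rise-pair₂ : ∀ y → rise y (h ℕ.+ h) ≡ ∏ h (λ i → y * (y + P) + d i)
  rise-pair₂ y = begin
    rise y (h ℕ.+ h)
      ≡⟨ ∏-even-odd h (λ i → y + (1ℤ + i)) ⟩
    ∏ h (λ i → y + (1ℤ + + 2 * + i)) * ∏ h (λ i → y + (1ℤ + (1ℤ + + 2 * + i)))
      ≡⟨ cong (_* ∏ h (λ i → y + (1ℤ + (1ℤ + + 2 * + i)))) (∏-reverse h (λ i → y + (1ℤ + + 2 * i))) ⟩
    ∏ h (λ i → y + (1ℤ + + 2 * (+ h - 1ℤ - + i))) * ∏ h (λ i → y + (1ℤ + (1ℤ + + 2 * + i)))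
      ≡⟨ ∏-* h _ _ ⟨
    ∏ h (λ i → (y + (1ℤ + + 2 * (+ h - 1ℤ - + i))) * (y + (1ℤ + (1ℤ + + 2 * + i))))
      ≡⟨ ∏-cong h (λ i _ → trans (lemma y (+ h) (+ i))
           (cong (λ P → y * (y + P) + + 2 * + suc i * (P - + 2 * + suc i)) (sym P≡1+2h))) ⟩
    ∏ h (λ i → y * (y + P) + d i) ∎
    where
    open ≡-Reasoning
    lemma : ∀ y h i → (y + (1ℤ + + 2 * (h - 1ℤ - i))) * (y + (1ℤ + (1ℤ + + 2 * i))) ≡
      y * (y + (1ℤ + (h + h))) + + 2 * (1ℤ + i) * (1ℤ + (h + h) - + 2 * (1ℤ + i))
    lemma = solve-∀

module Wolstenholme (p : ℕ) (p-prime : Prime p) (h : ℕ) (p≡1+2h : p ≡ suc (h ℕ.+ h))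
                    (2≤h : 2 ℕ.≤ h) where

  open Units p p-prime
  open Pairing h P (cong +_ p≡1+2h) using (c; d; rise-pair; rise-pair₂)

  w : ℤ
  w = fac (h ℕ.+ h)

  unit-w : Unit w
  unit-w = unit-fac (h ℕ.+ h) (subst (h ℕ.+ h ℕ.<_) (sym p≡1+2h) (ℕ.n<1+n (h ℕ.+ h)))

  ∏c≡w : ∏ h c ≡ w
  ∏c≡w = begin
    ∏ h c                                ≡⟨ ∏-cong h (λ i _ → sym (+-identityˡ (c i))) ⟩
    ∏ h (λ i → 0ℤ * (0ℤ + P) + c i)      ≡⟨ rise-pair 0ℤ ⟨
    rise 0ℤ (h ℕ.+ h)                    ≡⟨ fac≡rise (h ℕ.+ h) ⟩
    w                                    ∎
    where open ≡-Reasoning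

  ∏d≡w : ∏ h d ≡ w
  ∏d≡w = begin
    ∏ h d                                ≡⟨ ∏-cong h (λ i _ → sym (+-identityˡ (d i))) ⟩
    ∏ h (λ i → 0ℤ * (0ℤ + P) + d i)      ≡⟨ rise-pair₂ 0ℤ ⟨
    rise 0ℤ (h ℕ.+ h)                    ≡⟨ fac≡rise (h ℕ.+ h) ⟩
    w                                    ∎
    where open ≡-Reasoning

  d≈4c : ∀ i → d i ≈ + 4 * c i ⟨mod P ⟩
  d≈4c i = by (- (+ 2 * + suc i)) (lemma P (+ suc i))
    where
    lemma : ∀ P j → + 2 * j * (P - + 2 * j) ≡ + 4 * (j * (P - j)) + - (+ 2 * j) * P
    lemma = solve-∀

  -- Both pairings expand the same number rise P (p - 1).
  e₁c≈e₁d : e₁ h c ≈ e₁ h d ⟨mod P ⟩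
  e₁c≈e₁d with ∏-expand h c (P * (P + P)) | ∏-expand h d (P * (P + P))
  ... | k , eq | l , eq′ = by ((l - k) * (P + P)) $ begin
    e₁ h c
      ≡⟨ lemma (e₁ h c) k z ⟩
    (e₁ h c + k * z) - k * z
      ≡⟨ cong (_- k * z) (*-cancelʳ-≡ (e₁ h c + k * z) (e₁ h d + l * z) z
           {{i*j≢0 P (P + P) {{P-nonZero}} {{double-nonZero p P-nonZero}}}}
           (∙-cancelˡ w ((e₁ h c + k * z) * z) ((e₁ h d + l * z) * z) both)) ⟩
    (e₁ h d + l * z) - k * z
      ≡⟨ lemma′ (e₁ h d) k l P ⟩
    e₁ h d + (l - k) * (P + P) * P ∎
    where
    open ≡-Reasoning
    open import Algebra.Properties.Group (AbelianGroup.group +-0-abelianGroup) using (∙-cancelˡ)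
    double-nonZero : ∀ n → ℕ.NonZero n → ℕ.NonZero (n ℕ.+ n)
    double-nonZero (suc n) _ = _
    z : ℤ
    -- The value of y (y + P) at y = P. It is nonzero, so it cancels exactly, and it is a multiple
    -- of P, so the higher terms vanish modulo P.
    z = P * (P + P)
    both : w + (e₁ h c + k * z) * z ≡ w + (e₁ h d + l * z) * z
    both = begin
      w + (e₁ h c + k * z) * z        ≡⟨ cong (_+ (e₁ h c + k * z) * z) ∏c≡w ⟨
      ∏ h c + (e₁ h c + k * z) * z    ≡⟨ eq ⟨
      ∏ h (λ i → z + c i)             ≡⟨ rise-pair P ⟨
      rise P (h ℕ.+ h)                ≡⟨ rise-pair₂ P ⟩
      ∏ h (λ i → z + d i)             ≡⟨ eq′ ⟩
      ∏ h d + (e₁ h d + l * z) * z    ≡⟨ cong (_+ (e₁ h d + l * z) * z) ∏d≡w ⟩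
      w + (e₁ h d + l * z) * z        ∎
    lemma : ∀ b k z → b ≡ (b + k * z) - k * z
    lemma = solve-∀
    lemma′ : ∀ b k l P → (b + l * (P * (P + P))) - k * (P * (P + P)) ≡ b + (l - k) * (P + P) * P
    lemma′ = solve-∀

  -- Since d ≡ 4c, the two pairings also give 4 e₁ ≡ 4ʰ e₁ and w ≡ 4ʰ w.
  e₁c≈0 : e₁ h c ≈ 0ℤ ⟨mod P ⟩
  e₁c≈0 = unit-cancel₁ (unit-* {+ 3} {w} (unit-small ℕ.z<s 3<p) unit-w)
            (combine w (e₁ h c) (e₁ h d) ((+ 4) ^ h) e₁c≈e₁d (e₁-scale h (+ 4) d≈4c) 4ʰw≈w)
    where
    3<p : 3 ℕ.< p
    3<p = subst (3 ℕ.<_) (sym p≡1+2h)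
            (ℕ.s≤s (ℕ.≤-trans (ℕ.s≤s (ℕ.s≤s (ℕ.s≤s ℕ.z≤n))) (ℕ.+-mono-≤ 2≤h 2≤h)))
    4ʰw≈w : (+ 4) ^ h * w ≈ w ⟨mod P ⟩
    4ʰw≈w = ≈-sym (subst₂ (λ a b → a ≈ (+ 4) ^ h * b ⟨mod P ⟩) ∏d≡w ∏c≡w (∏-scale h (+ 4) d≈4c))
    combine : ∀ {m} w a b f → a ≈ b ⟨mod m ⟩ → + 4 * b ≈ f * a ⟨mod m ⟩ → f * w ≈ w ⟨mod m ⟩ →
              + 3 * w * a ≈ + 3 * w * 0ℤ ⟨mod m ⟩
    combine {m} w a b f a≈b 4b≈fa fw≈w = begin
      + 3 * w * a                    ≡⟨ lemma w a ⟩
      w * (+ 4 * a) - w * a          ≈⟨ +-≈ (*-≈ˡ w (*-≈ˡ (+ 4) a≈b)) ≈-refl ⟩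
      w * (+ 4 * b) - w * a          ≈⟨ +-≈ (*-≈ˡ w 4b≈fa) ≈-refl ⟩
      w * (f * a) - w * a            ≡⟨ lemma′ w f a ⟩
      f * w * a - w * a              ≈⟨ +-≈ (*-≈ʳ a fw≈w) ≈-refl ⟩
      w * a - w * a                  ≡⟨ lemma″ w a ⟩
      + 3 * w * 0ℤ                   ∎
      where
      open ≈-Reasoning m
      lemma : ∀ w b → + 3 * w * b ≡ w * (+ 4 * b) - w * b
      lemma = solve-∀
      lemma′ : ∀ w f b → w * (f * b) - w * b ≡ f * w * b - w * b
      lemma′ = solve-∀
      lemma″ : ∀ w b → w * b - w * b ≡ + 3 * w * 0ℤ
      lemma″ = solve-∀

  -- At y = P k the variable z = y (y + P) is P² k (k + 1). The linear term `e₁ h c` * z gains a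
  -- third factor P from `e₁c≈0`, and the remaining terms contain z², hence P⁴.
  wolstenholme : ∀ k → rise (P * k) (h ℕ.+ h) ≈ w ⟨mod P ^ 3 ⟩
  wolstenholme k =
    ≈-trans (≈-reflexive (rise-pair (P * k)))
      (second-order ∏c≡w (≈0⇒∣ e₁c≈0) (∏-expand h c (P * k * (P * k + P))))
    where
    second-order : ∀ {P k s s′ e x} → s ≡ s′ → P ∣ e →
      ∃[ l ] x ≡ s + (e + l * (P * k * (P * k + P))) * (P * k * (P * k + P)) →
      x ≈ s′ ⟨mod P ^ 3 ⟩
    second-order {P} {k} {s} refl (divides b refl) (l , eq) =
      by (b * (k * (k + 1ℤ)) + l * P * (k * (k + 1ℤ) * (k * (k + 1ℤ))))
         (trans eq (lemma s b l P k))
      where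
      lemma : ∀ w b l P k → w + (b * P + l * (P * k * (P * k + P))) * (P * k * (P * k + P)) ≡
        w + (b * (k * (k + 1ℤ)) + l * P * (k * (k + 1ℤ) * (k * (k + 1ℤ)))) * (P * (P * (P * 1ℤ)))
      lemma = solve-∀

  -- The product of the numbers up to p a that are prime to p, which is the cofactor of pᵃ a! in (p
  -- a)!.
  φ : ℕ → ℤ
  φ a = ∏ a (λ k → rise (P * + k) (h ℕ.+ h))

  φ≈wᵃ : ∀ a → φ a ≈ w ^ a ⟨mod P ^ 3 ⟩
  φ≈wᵃ a = ≈-trans (∏-≈ a (λ k _ → wolstenholme (+ k))) (≈-reflexive (∏-const a w))

  fac-p* : ∀ a → fac (p ℕ.* a) ≡ P ^ a * fac a * φ a
  fac-p* zero    = cong fac (ℕ.*-zeroʳ p)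
  fac-p* (suc a) = begin
    fac (p ℕ.* suc a)
      ≡⟨ cong fac (trans (ℕ.*-suc p a) (ℕ.+-comm p (p ℕ.* a))) ⟩
    fac (p ℕ.* a ℕ.+ p)
      ≡⟨ rise-fac (p ℕ.* a) p ⟨
    rise (+ (p ℕ.* a)) p * fac (p ℕ.* a)
      ≡⟨ cong₂ (λ x y → rise x p * y) (pos-* p a) (fac-p* a) ⟩
    rise (P * + a) p * (P ^ a * fac a * φ a)
      ≡⟨ cong (_* (P ^ a * fac a * φ a)) (rise-p (P * + a)) ⟩
    rise (P * + a) (h ℕ.+ h) * (P * + a + P) * (P ^ a * fac a * φ a)
      ≡⟨ lemma (rise (P * + a) (h ℕ.+ h)) P (+ a) (P ^ a) (fac a) (φ a) ⟩
    P * P ^ a * (+ suc a * fac a) * (φ a * rise (P * + a) (h ℕ.+ h))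
      ≡⟨ cong (λ f → P * P ^ a * f * φ (suc a)) (fac-suc a) ⟨
    P ^ suc a * fac (suc a) * φ (suc a) ∎
    where
    open ≡-Reasoning
    rise-p : ∀ x → rise x p ≡ rise x (h ℕ.+ h) * (x + P)
    rise-p x = subst (λ p → rise x p ≡ rise x (h ℕ.+ h) * (x + + p)) (sym p≡1+2h) refl
    lemma : ∀ r P a x f s → r * (P * a + P) * (x * f * s) ≡ P * x * ((1ℤ + a) * f) * (s * r)
    lemma = solve-∀

-- Binomial coefficients through factorials

C-fac : ∀ a b → + ((a ℕ.+ b) C b) * (fac a * fac b) ≡ fac (a ℕ.+ b)
C-fac a b = begin
  + (n C b) * (fac a * fac b)          ≡⟨ cong (+ (n C b) *_) (trans (*-comm (fac a) (fac b)) (sym (pos-* (b !) (a !)))) ⟩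
  + (n C b) * + (b ! ℕ.* a !)          ≡⟨ pos-* (n C b) (b ! ℕ.* a !) ⟨
  + ((n C b) ℕ.* (b ! ℕ.* a !))        ≡⟨ cong (λ k → + ((n C b) ℕ.* (b ! ℕ.* k !))) (ℕ.m+n∸n≡m a b) ⟨
  + ((n C b) ℕ.* d)                    ≡⟨ cong (λ c → + (c ℕ.* d)) (nCk≡n!/k![n-k]! b≤n) ⟩
  + (((n !) ℕ./ d) ℕ.* d)              ≡⟨ cong +_ (ℕ.m/n*n≡m (k![n∸k]!∣n! b≤n)) ⟩
  fac n                                ∎
  where
  open ≡-Reasoning
  n = a ℕ.+ b
  d = b ! ℕ.* (n ℕ.∸ b) !
  b≤n : b ℕ.≤ n
  b≤n = ℕ.m≤n+m b a
  instance
    d≢0 : ℕ.NonZero d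
    d≢0 = b ℕ.!* (n ℕ.∸ b) !≢0

-- The sum ∑ᵣ 3ˣ⁻³ʳ t x r

-- For 1 ≤ x and 3r ≤ x this is x (x-r-1)! / ((x-3r)! r! r!).
t : ℕ → ℕ → ℤ
t x zero      = 1ℤ
t x r@(suc s) = + ((x ℕ.∸ r) C (r ℕ.+ r)) * + ((r ℕ.+ r) C r)
              + + ((x ℕ.∸ suc r) C (s ℕ.+ r)) * + ((s ℕ.+ r) C r)

-- Here z = x - r - 1 and e = x - 3r. The two summands of `t` come from x z! = (x - r)! + r z!: each
-- part, divided by e! r! r!, is a product of two binomial coefficients. This is why `t` is an
-- integer although x (x-r-1)! / ((x-3r)! r! r!) is not visibly one.
t-fac : ∀ e r z → e ℕ.+ 3 ℕ.* r ≡ suc (z ℕ.+ r) →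
        t (suc (z ℕ.+ r)) r * (fac e * (fac r * fac r)) ≡ + suc (z ℕ.+ r) * fac z
t-fac e zero z eq = begin
  1ℤ * (fac e * (1ℤ * 1ℤ))          ≡⟨ lemma (fac e) ⟩
  fac e                             ≡⟨ cong fac (trans (sym (ℕ.+-identityʳ e)) (trans eq (cong suc (ℕ.+-identityʳ z)))) ⟩
  fac (suc z)                       ≡⟨ fac-suc z ⟩
  + suc z * fac z                   ≡⟨ cong (λ y → + suc y * fac z) (ℕ.+-identityʳ z) ⟨
  + suc (z ℕ.+ 0) * fac z           ∎
  where
  open ≡-Reasoning
  lemma : ∀ e → 1ℤ * (e * (1ℤ * 1ℤ)) ≡ e
  lemma = solve-∀
t-fac e r@(suc s) z eq = begin
  (+ ((x ℕ.∸ r) C (r ℕ.+ r)) * b + + ((x ℕ.∸ suc r) C (s ℕ.+ r)) * b′) * (fac e * (fac r * fac r))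
    ≡⟨ cong₂ (λ k l → (+ (k C (r ℕ.+ r)) * b + + (l C (s ℕ.+ r)) * b′) * (fac e * (fac r * fac r)))
         (trans (ℕ.m+n∸n≡m (suc z) r) 1+z≡) (trans (ℕ.m+n∸n≡m z r) z≡) ⟩
  (a * b + a′ * b′) * (fac e * (fac r * fac r))
    ≡⟨ cong (λ f → (a * b + a′ * b′) * (fac e * (fac r * f))) (fac-suc s) ⟩
  (a * b + a′ * b′) * (fac e * (fac r * (+ r * fac s)))
    ≡⟨ split a b a′ b′ (fac e) (fac r) (+ r) (fac s) ⟩
  a * (fac e * (b * (fac r * (+ r * fac s)))) + + r * (a′ * (fac e * (b′ * (fac s * fac r))))
    ≡⟨ cong₂ (λ u v → a * (fac e * (b * (fac r * u))) + + r * (a′ * (fac e * v))) (sym (fac-suc s)) (C-fac s r) ⟩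
  a * (fac e * (b * (fac r * fac r))) + + r * (a′ * (fac e * fac (s ℕ.+ r)))
    ≡⟨ cong₂ (λ u v → a * (fac e * u) + + r * v) (C-fac r r) (C-fac e (s ℕ.+ r)) ⟩
  a * (fac e * fac (r ℕ.+ r)) + + r * fac (e ℕ.+ (s ℕ.+ r))
    ≡⟨ cong₂ (λ u v → u + + r * fac v) (C-fac e (r ℕ.+ r)) (sym z≡) ⟩
  fac (e ℕ.+ (r ℕ.+ r)) + + r * fac z
    ≡⟨ cong (λ n → fac n + + r * fac z) (sym 1+z≡) ⟩
  fac (suc z) + + r * fac z
    ≡⟨ cong (_+ + r * fac z) (fac-suc z) ⟩
  + suc z * fac z + + r * fac z
    ≡⟨ *-distribʳ-+ (fac z) (+ suc z) (+ r) ⟨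
  + suc (z ℕ.+ r) * fac z ∎
  where
  open ≡-Reasoning
  x = suc (z ℕ.+ r)
  a = + ((e ℕ.+ (r ℕ.+ r)) C (r ℕ.+ r))
  a′ = + ((e ℕ.+ (s ℕ.+ r)) C (s ℕ.+ r))
  b = + ((r ℕ.+ r) C r)
  b′ = + ((s ℕ.+ r) C r)
  1+z≡ : suc z ≡ e ℕ.+ (r ℕ.+ r)
  1+z≡ = ℕ.+-cancelʳ-≡ r (suc z) (e ℕ.+ (r ℕ.+ r)) (trans (sym eq) (lemma e r))
    where
    lemma : ∀ e r → e ℕ.+ 3 ℕ.* r ≡ e ℕ.+ (r ℕ.+ r) ℕ.+ r
    lemma = ℕ-Solver.solve-∀
  z≡ : z ≡ e ℕ.+ (s ℕ.+ r)
  z≡ = ℕ.suc-injective (trans 1+z≡ (ℕ.+-suc e (s ℕ.+ r)))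
  split : ∀ a b a′ b′ e r n s → (a * b + a′ * b′) * (e * (r * (n * s))) ≡
          a * (e * (b * (r * (n * s)))) + n * (a′ * (e * (b′ * (s * r))))
  split = solve-∀

t-zero : ∀ x r → x ℕ.< 3 ℕ.* r → t x r ≡ 0ℤ
t-zero x r@(suc s) x<3r = cong₂ _+_
  (trans (cong (λ c → + c * + ((r ℕ.+ r) C r)) (k>n⇒nCk≡0 (ℕ.m<n+o⇒m∸n<o x r
    (subst (x ℕ.<_) (lemma r) x<3r)))) (*-zeroˡ (+ ((r ℕ.+ r) C r))))
  (trans (cong (λ c → + c * + ((s ℕ.+ r) C r)) (k>n⇒nCk≡0 (ℕ.m<n+o⇒m∸n<o x (suc r)
    {{ℕ.≢-nonZero (λ s+r≡0 → ℕ.1+n≢0 (trans (sym (ℕ.+-suc s s)) s+r≡0))}}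
    (subst (x ℕ.<_) (lemma′ s) x<3r)))) (*-zeroˡ (+ ((s ℕ.+ r) C r))))
  where
  lemma : ∀ r → 3 ℕ.* r ≡ r ℕ.+ (r ℕ.+ r)
  lemma = ℕ-Solver.solve-∀
  lemma′ : ∀ s → 3 ℕ.* suc s ≡ suc (suc s) ℕ.+ (s ℕ.+ suc s)
  lemma′ = ℕ-Solver.solve-∀

module WZ where

  F : ℕ → ℕ → ℤ
  F x r = (+ 3) ^ (x ℕ.∸ 3 ℕ.* r) * t x r

  -- (x-1-s)! / ((x-2-3s)! s! s!)
  γ : ℕ → ℕ → ℤ
  γ x s = + ((x ℕ.∸ suc s) C (suc s ℕ.+ s)) * (+ suc (s ℕ.+ s) * + ((s ℕ.+ s) C s))

  -- For x ≥ 1, `G x (suc s)` is `F x s` times the rational certificate 3 (x - 3s)(x - 3s - 1) / x.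
  -- Going through `γ` absorbs the division by x.
  G : ℕ → ℕ → ℤ
  G x zero    = 0ℤ
  G x (suc s) = + 3 * (+ 3) ^ (x ℕ.∸ 3 ℕ.* s) * γ x s

  γ-fac : ∀ e s y → suc (suc (e ℕ.+ 3 ℕ.* s)) ≡ suc (y ℕ.+ s) →
          γ (suc (y ℕ.+ s)) s * (fac e * (fac s * fac s)) ≡ fac y
  γ-fac e s y eq = begin
    + ((suc (y ℕ.+ s) ℕ.∸ suc s) C m) * (k * b) * (fac e * (fac s * fac s))
      ≡⟨ cong (λ n → + (n C m) * (k * b) * (fac e * (fac s * fac s))) (trans (ℕ.m+n∸n≡m y s) y≡) ⟩
    a * (k * b) * (fac e * (fac s * fac s))
      ≡⟨ lemma a b k (fac e) (fac s) ⟩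
    a * (fac e * (k * (b * (fac s * fac s))))
      ≡⟨ cong (λ f → a * (fac e * (k * f))) (C-fac s s) ⟩
    a * (fac e * (k * fac (s ℕ.+ s)))
      ≡⟨ cong (λ f → a * (fac e * f)) (fac-suc (s ℕ.+ s)) ⟨
    a * (fac e * fac m)
      ≡⟨ C-fac e m ⟩
    fac (e ℕ.+ m)
      ≡⟨ cong fac y≡ ⟨
    fac y ∎
    where
    open ≡-Reasoning
    m = suc s ℕ.+ s
    k = + suc (s ℕ.+ s)
    b = + ((s ℕ.+ s) C s)
    a = + ((e ℕ.+ m) C m)
    y≡ : y ≡ e ℕ.+ m
    y≡ = ℕ.+-cancelʳ-≡ s y (e ℕ.+ m) (trans (sym (ℕ.suc-injective eq)) (lemma e s))
      where
      lemma : ∀ e s → suc (e ℕ.+ 3 ℕ.* s) ≡ e ℕ.+ (suc s ℕ.+ s) ℕ.+ s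
      lemma = ℕ-Solver.solve-∀
    lemma : ∀ a b k e s → a * (k * b) * (e * (s * s)) ≡ a * (e * (k * (b * (s * s))))
    lemma = solve-∀

  F-zero : ∀ x r → x ℕ.< 3 ℕ.* r → F x r ≡ 0ℤ
  F-zero x r x<3r =
    trans (cong ((+ 3) ^ (x ℕ.∸ 3 ℕ.* r) *_) (t-zero x r x<3r)) (*-zeroʳ ((+ 3) ^ (x ℕ.∸ 3 ℕ.* r)))

  G-zero : ∀ x s → x ℕ.< 2 ℕ.+ 3 ℕ.* s → G x (suc s) ≡ 0ℤ
  G-zero x s x<2+3s = trans (cong (λ c → u * (+ c * v)) (k>n⇒nCk≡0 (ℕ.m<n+o⇒m∸n<o x (suc s)
    (subst (x ℕ.<_) (lemma s) x<2+3s)))) (trans (cong (u *_) (*-zeroˡ v)) (*-zeroʳ u))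
    where
    u = + 3 * (+ 3) ^ (x ℕ.∸ 3 ℕ.* s)
    v = + suc (s ℕ.+ s) * + ((s ℕ.+ s) C s)
    lemma : ∀ s → 2 ℕ.+ 3 ℕ.* s ≡ suc s ℕ.+ (suc s ℕ.+ s)
    lemma = ℕ-Solver.solve-∀

  -- F and G form a WZ pair.  Here e = x + 1 - 3r and y = x - 1 - r; multiplying by
  -- M = e! r! r! turns every term into a polynomial multiple of 3ᵉ y!, including the
  -- boundary cases e ≤ 2, in which some of the terms vanish.
  module Step (e r y : ℕ) (e+3r≡ : e ℕ.+ 3 ℕ.* r ≡ suc (suc (y ℕ.+ r))) where

    x : ℕ
    x = suc (y ℕ.+ r)

    M K : ℤ
    M = fac e * (fac r * fac r)
    K = fac y

    F-next : F (suc x) r * M ≡ (+ 3) ^ e * (+ suc x * (+ suc y * K))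
    F-next = begin
      (+ 3) ^ (suc x ℕ.∸ 3 ℕ.* r) * t (suc x) r * M
        ≡⟨ cong (λ n → (+ 3) ^ n * t (suc x) r * M)
             (trans (cong (ℕ._∸ 3 ℕ.* r) (sym e+3r≡)) (ℕ.m+n∸n≡m e (3 ℕ.* r))) ⟩
      (+ 3) ^ e * t (suc x) r * M
        ≡⟨ *-assoc ((+ 3) ^ e) (t (suc x) r) M ⟩
      (+ 3) ^ e * (t (suc x) r * M)
        ≡⟨ cong ((+ 3) ^ e *_) (t-fac e r (suc y) e+3r≡) ⟩
      (+ 3) ^ e * (+ suc x * fac (suc y))
        ≡⟨ cong (λ f → (+ 3) ^ e * (+ suc x * f)) (fac-suc y) ⟩
      (+ 3) ^ e * (+ suc x * (+ suc y * K)) ∎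
      where open ≡-Reasoning

    F-this : + 3 * F x r * M ≡ (+ 3) ^ e * (+ e * (+ x * K))
    F-this = by-cases e e+3r≡
      where
      open ≡-Reasoning
      by-cases : ∀ e → e ℕ.+ 3 ℕ.* r ≡ suc x →
                 + 3 * F x r * (fac e * (fac r * fac r)) ≡ (+ 3) ^ e * (+ e * (+ x * K))
      by-cases zero eq = begin
        + 3 * F x r * (1ℤ * (fac r * fac r))
          ≡⟨ cong (λ f → + 3 * f * (1ℤ * (fac r * fac r))) (F-zero x r (ℕ.≤-reflexive (sym eq))) ⟩
        + 3 * 0ℤ * (1ℤ * (fac r * fac r))
          ≡⟨ lemma (fac r) (+ x * K) ⟩
        1ℤ * (0ℤ * (+ x * K)) ∎
        where
        lemma : ∀ f k → + 3 * 0ℤ * (1ℤ * (f * f)) ≡ 1ℤ * (0ℤ * k)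
        lemma = solve-∀
      by-cases (suc e) eq = begin
        + 3 * ((+ 3) ^ (x ℕ.∸ 3 ℕ.* r) * t x r) * (fac (suc e) * (fac r * fac r))
          ≡⟨ cong₂ (λ n f → + 3 * ((+ 3) ^ n * t x r) * (f * (fac r * fac r)))
               (trans (cong (ℕ._∸ 3 ℕ.* r) (sym (ℕ.suc-injective eq))) (ℕ.m+n∸n≡m e (3 ℕ.* r))) (fac-suc e) ⟩
        + 3 * ((+ 3) ^ e * t x r) * (+ suc e * fac e * (fac r * fac r))
          ≡⟨ lemma ((+ 3) ^ e) (t x r) (+ suc e) (fac e) (fac r * fac r) ⟩
        + 3 * (+ 3) ^ e * (+ suc e * (t x r * (fac e * (fac r * fac r))))
          ≡⟨ cong (λ u → + 3 * (+ 3) ^ e * (+ suc e * u)) (t-fac e r y (ℕ.suc-injective eq)) ⟩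
        + 3 * (+ 3) ^ e * (+ suc e * (+ x * K)) ∎
        where
        lemma : ∀ q t n f m → + 3 * (q * t) * (n * f * m) ≡ + 3 * q * (n * (t * (f * m)))
        lemma = solve-∀

    G-next : G x (suc r) * M ≡ (+ 3) ^ e * (+ e * (+ e - 1ℤ) * (+ e - + 2) * K)
    G-next = by-cases e e+3r≡
      where
      open ≡-Reasoning
      vanish : ∀ e → + e * (+ e - 1ℤ) * (+ e - + 2) ≡ 0ℤ → x ℕ.< 2 ℕ.+ 3 ℕ.* r →
               G x (suc r) * (fac e * (fac r * fac r)) ≡
               (+ 3) ^ e * (+ e * (+ e - 1ℤ) * (+ e - + 2) * K)
      vanish e e-zero x<2+3r = begin
        G x (suc r) * (fac e * (fac r * fac r))
          ≡⟨ cong (_* (fac e * (fac r * fac r))) (G-zero x r x<2+3r) ⟩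
        0ℤ * (fac e * (fac r * fac r))
          ≡⟨ lemma (fac e * (fac r * fac r)) ((+ 3) ^ e) K ⟩
        (+ 3) ^ e * (0ℤ * K)
          ≡⟨ cong (λ z → (+ 3) ^ e * (z * K)) e-zero ⟨
        (+ 3) ^ e * (+ e * (+ e - 1ℤ) * (+ e - + 2) * K) ∎
        where
        lemma : ∀ m q k → 0ℤ * m ≡ q * (0ℤ * k)
        lemma = solve-∀
      by-cases : ∀ e → e ℕ.+ 3 ℕ.* r ≡ suc x →
                 G x (suc r) * (fac e * (fac r * fac r)) ≡
                 (+ 3) ^ e * (+ e * (+ e - 1ℤ) * (+ e - + 2) * K)
      by-cases 0 eq = vanish 0 refl (ℕ.≤-trans (ℕ.≤-reflexive (sym eq)) (ℕ.m≤n+m (3 ℕ.* r) 2))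
      by-cases 1 eq = vanish 1 refl (ℕ.≤-trans (ℕ.≤-reflexive (sym eq)) (ℕ.n≤1+n (1 ℕ.+ 3 ℕ.* r)))
      by-cases 2 eq = vanish 2 refl (ℕ.≤-reflexive (sym eq))
      by-cases (suc (suc (suc e))) eq = begin
        + 3 * (+ 3) ^ (x ℕ.∸ 3 ℕ.* r) * γ x r * (fac (3 ℕ.+ e) * (fac r * fac r))
          ≡⟨ cong₂ (λ n f → + 3 * (+ 3) ^ n * γ x r * (f * (fac r * fac r)))
               (trans (cong (ℕ._∸ 3 ℕ.* r) (sym (ℕ.suc-injective eq))) (ℕ.m+n∸n≡m (2 ℕ.+ e) (3 ℕ.* r))) fac-3+e ⟩
        + 3 * (+ 3) ^ (2 ℕ.+ e) * γ x r * ((+ 3 + + e) * ((+ 2 + + e) * ((1ℤ + + e) * fac e)) * (fac r * fac r))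
          ≡⟨ lemma ((+ 3) ^ (2 ℕ.+ e)) (γ x r) (+ e) (fac e) (fac r * fac r) ⟩
        + 3 * (+ 3) ^ (2 ℕ.+ e) * ((+ 3 + + e) * (+ 3 + + e - 1ℤ) * (+ 3 + + e - + 2) * (γ x r * (fac e * (fac r * fac r))))
          ≡⟨ cong (λ u → + 3 * (+ 3) ^ (2 ℕ.+ e) * ((+ 3 + + e) * (+ 3 + + e - 1ℤ) * (+ 3 + + e - + 2) * u))
               (γ-fac e r y (ℕ.suc-injective eq)) ⟩
        + 3 * (+ 3) ^ (2 ℕ.+ e) * ((+ 3 + + e) * (+ 3 + + e - 1ℤ) * (+ 3 + + e - + 2) * K) ∎
        where
        fac-3+e : fac (3 ℕ.+ e) ≡ (+ 3 + + e) * ((+ 2 + + e) * ((1ℤ + + e) * fac e))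
        fac-3+e = trans (fac-suc (2 ℕ.+ e)) (cong ((+ 3 + + e) *_)
                    (trans (fac-suc (1 ℕ.+ e)) (cong ((+ 2 + + e) *_) (fac-suc e))))
        lemma : ∀ q g e f m → + 3 * q * g * ((+ 3 + e) * ((+ 2 + e) * ((1ℤ + e) * f)) * m) ≡
                + 3 * q * ((+ 3 + e) * (+ 3 + e - 1ℤ) * (+ 3 + e - + 2) * (g * (f * m)))
        lemma = solve-∀

    G-this : G x r * M ≡ (+ 3) ^ e * (+ 27 * (+ r * + r) * (+ suc y * K))
    G-this = by-cases r refl
      where
      open ≡-Reasoning
      by-cases : ∀ s → s ≡ r →
        G x s * (fac e * (fac s * fac s)) ≡ (+ 3) ^ e * (+ 27 * (+ s * + s) * (+ suc y * K))
      by-cases zero _ = lemma (fac e * (fac 0 * fac 0)) ((+ 3) ^ e) (+ suc y * K)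
        where
        lemma : ∀ m q k → 0ℤ * m ≡ q * (+ 27 * (0ℤ * 0ℤ) * k)
        lemma = solve-∀
      by-cases (suc s) refl = begin
        + 3 * (+ 3) ^ (x ℕ.∸ 3 ℕ.* s) * γ x s * (fac e * (fac (suc s) * fac (suc s)))
          ≡⟨ cong₂ (λ n f → + 3 * (+ 3) ^ n * γ x s * (fac e * (f * f)))
               (trans (cong (ℕ._∸ 3 ℕ.* s) (sym shift)) (ℕ.m+n∸n≡m (2 ℕ.+ e) (3 ℕ.* s))) (fac-suc s) ⟩
        + 3 * (+ 3 * (+ 3 * (+ 3) ^ e)) * γ x s * (fac e * (+ suc s * fac s * (+ suc s * fac s)))
          ≡⟨ lemma ((+ 3) ^ e) (γ x s) (fac e) (+ suc s) (fac s) ⟩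
        (+ 3) ^ e * (+ 27 * (+ suc s * + suc s) * (γ x s * (fac e * (fac s * fac s))))
          ≡⟨ cong (λ x → (+ 3) ^ e * (+ 27 * (+ suc s * + suc s) * (γ x s * (fac e * (fac s * fac s)))))
               (cong suc (ℕ.+-suc y s)) ⟩
        (+ 3) ^ e * (+ 27 * (+ suc s * + suc s) * (γ (suc (suc y ℕ.+ s)) s * (fac e * (fac s * fac s))))
          ≡⟨ cong (λ u → (+ 3) ^ e * (+ 27 * (+ suc s * + suc s) * u))
               (γ-fac e s (suc y) (trans shift (cong suc (ℕ.+-suc y s)))) ⟩
        (+ 3) ^ e * (+ 27 * (+ suc s * + suc s) * fac (suc y))
          ≡⟨ cong (λ u → (+ 3) ^ e * (+ 27 * (+ suc s * + suc s) * u)) (fac-suc y) ⟩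
        (+ 3) ^ e * (+ 27 * (+ suc s * + suc s) * (+ suc y * K)) ∎
        where
        shift : 2 ℕ.+ e ℕ.+ 3 ℕ.* s ≡ x
        shift = ℕ.suc-injective (trans (arith e s) e+3r≡)
          where
          arith : ∀ e s → suc (2 ℕ.+ e ℕ.+ 3 ℕ.* s) ≡ e ℕ.+ 3 ℕ.* suc s
          arith = ℕ-Solver.solve-∀
        lemma : ∀ q g e n f → + 3 * (+ 3 * (+ 3 * q)) * g * (e * (n * f * (n * f))) ≡
                q * (+ 27 * (n * n) * (g * (e * (f * f))))
        lemma = solve-∀

    M-nonZero : NonZero M
    M-nonZero = i*j≢0 (fac e) (fac r * fac r) {{fac-nonZero e}}
                  {{i*j≢0 (fac r) (fac r) {{fac-nonZero r}} {{fac-nonZero r}}}}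

    certificate : + 3 * + suc x * F (suc x) r - (+ 4 * + x + + 2) * (+ 3 * F x r) ≡ G x r - G x (suc r)
    certificate = *-cancelʳ-≡ _ _ M {{M-nonZero}} $ begin
      (+ 3 * + suc x * F (suc x) r - (+ 4 * + x + + 2) * (+ 3 * F x r)) * M
        ≡⟨ expand (+ suc x) (F (suc x) r) (+ 4 * + x + + 2) (F x r) M ⟩
      + 3 * + suc x * (F (suc x) r * M) - (+ 4 * + x + + 2) * (+ 3 * F x r * M)
        ≡⟨ cong₂ (λ u v → + 3 * + suc x * u - (+ 4 * + x + + 2) * v) F-next F-this ⟩
      + 3 * + suc x * (q * (+ suc x * (+ suc y * K))) - (+ 4 * + x + + 2) * (q * (+ e * (+ x * K)))
        ≡⟨ cong (λ e → + 3 * + suc x * (q * (+ suc x * (+ suc y * K))) - (+ 4 * + x + + 2) * (q * (e * (+ x * K)))) e≡ ⟩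
      + 3 * + suc x * (q * (+ suc x * (+ suc y * K))) - (+ 4 * + x + + 2) * (q * (e′ (+ y) (+ r) * (+ x * K)))
        ≡⟨ identity (+ y) (+ r) q K ⟩
      q * (+ 27 * (+ r * + r) * (+ suc y * K)) - q * (e′ (+ y) (+ r) * (e′ (+ y) (+ r) - 1ℤ) * (e′ (+ y) (+ r) - + 2) * K)
        ≡⟨ cong (λ e → q * (+ 27 * (+ r * + r) * (+ suc y * K)) - q * (e * (e - 1ℤ) * (e - + 2) * K)) e≡ ⟨
      q * (+ 27 * (+ r * + r) * (+ suc y * K)) - q * (+ e * (+ e - 1ℤ) * (+ e - + 2) * K)
        ≡⟨ cong₂ _-_ G-this G-next ⟨
      G x r * M - G x (suc r) * M
        ≡⟨ factor (G x r) (G x (suc r)) M ⟩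
      (G x r - G x (suc r)) * M ∎
      where
      open ≡-Reasoning
      q = (+ 3) ^ e
      e′ : ℤ → ℤ → ℤ
      e′ y r = + 2 + (y + r) - + 3 * r
      e≡ : + e ≡ e′ (+ y) (+ r)
      e≡ = begin
        + e                               ≡⟨ cancel (+ e) (+ r) ⟩
        + e + + 3 * + r - + 3 * + r       ≡⟨ cong (λ z → + e + z - + 3 * + r) (sym (pos-* 3 r)) ⟩
        + (e ℕ.+ 3 ℕ.* r) - + 3 * + r     ≡⟨ cong (λ n → + n - + 3 * + r) e+3r≡ ⟩
        e′ (+ y) (+ r)                    ∎
        where
        cancel : ∀ e r → e ≡ e + + 3 * r - + 3 * r
        cancel = solve-∀
      expand : ∀ n f l g m → (+ 3 * n * f - l * (+ 3 * g)) * m ≡ + 3 * n * (f * m) - l * (+ 3 * g * m)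
      expand = solve-∀
      factor : ∀ a b m → a * m - b * m ≡ (a - b) * m
      factor = solve-∀
      identity : ∀ y r q K →
        + 3 * (+ 2 + (y + r)) * (q * ((+ 2 + (y + r)) * ((1ℤ + y) * K)))
          - (+ 4 * (1ℤ + (y + r)) + + 2) * (q * ((+ 2 + (y + r) - + 3 * r) * ((1ℤ + (y + r)) * K)))
        ≡ q * (+ 27 * (r * r) * ((1ℤ + y) * K))
          - q * ((+ 2 + (y + r) - + 3 * r) * (+ 2 + (y + r) - + 3 * r - 1ℤ) * (+ 2 + (y + r) - + 3 * r - + 2) * K)
      identity = solve-∀

-- Ensures that y = x - 1 - r is a natural number as soon as e = x + 1 - 3r is one, as `Step`
-- requires. It fails at x = r = 0, so the recurrence can start only at x = 1.
3r≤1+x⇒r<x : ∀ x r → 1 ℕ.≤ x → 3 ℕ.* r ℕ.≤ suc x → r ℕ.< x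
3r≤1+x⇒r<x x zero    1≤x _      = 1≤x
3r≤1+x⇒r<x x (suc s) _   3r≤1+x = ℕ.s≤s⁻¹ (ℕ.≤-trans
  (ℕ.≤-trans (ℕ.m≤m+n (suc (suc (suc s))) (2 ℕ.* s)) (ℕ.≤-reflexive (lemma s))) 3r≤1+x)
  where
  lemma : ∀ s → suc (suc (suc s)) ℕ.+ 2 ℕ.* s ≡ 3 ℕ.* suc s
  lemma = ℕ-Solver.solve-∀

-- The closed form by telescoping

module HypergeometricSum where

  open WZ

  certificate : ∀ x r → 1 ℕ.≤ x →
    + 3 * + suc x * F (suc x) r - (+ 4 * + x + + 2) * (+ 3 * F x r) ≡ G x r - G x (suc r)
  certificate x r 1≤x with 3 ℕ.* r ℕ.≤? suc x
  ... | yes 3r≤1+x = subst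
      (λ x → + 3 * + suc x * F (suc x) r - (+ 4 * + x + + 2) * (+ 3 * F x r) ≡ G x r - G x (suc r))
      1+y+r≡x
      (Step.certificate (suc x ℕ.∸ 3 ℕ.* r) r (x ℕ.∸ suc r)
        (trans (ℕ.m∸n+n≡m 3r≤1+x) (cong suc (sym 1+y+r≡x))))
    where
    1+y+r≡x : suc (x ℕ.∸ suc r ℕ.+ r) ≡ x
    1+y+r≡x = trans (sym (ℕ.+-suc (x ℕ.∸ suc r) r)) (ℕ.m∸n+n≡m (3r≤1+x⇒r<x x r 1≤x 3r≤1+x))
  -- Beyond the support all four terms are zero.
  ... | no 3r≰1+x = begin
      + 3 * + suc x * F (suc x) r - (+ 4 * + x + + 2) * (+ 3 * F x r)
        ≡⟨ cong₂ (λ u v → + 3 * + suc x * u - (+ 4 * + x + + 2) * (+ 3 * v))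
             (F-zero (suc x) r 1+x<3r) (F-zero x r (ℕ.<⇒≤ 1+x<3r)) ⟩
      + 3 * + suc x * 0ℤ - (+ 4 * + x + + 2) * (+ 3 * 0ℤ)
        ≡⟨ lemma (+ 3 * + suc x) (+ 4 * + x + + 2) ⟩
      0ℤ - 0ℤ
        ≡⟨ cong₂ _-_ (G-this r 1+x<3r) (G-zero x r (ℕ.<-≤-trans (ℕ.<⇒≤ 1+x<3r) (ℕ.m≤n+m (3 ℕ.* r) 2))) ⟨
      G x r - G x (suc r) ∎
    where
    open ≡-Reasoning
    1+x<3r : suc x ℕ.< 3 ℕ.* r
    1+x<3r = ℕ.≰⇒> 3r≰1+x
    lemma : ∀ a b → a * 0ℤ - b * (+ 3 * 0ℤ) ≡ 0ℤ - 0ℤ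
    lemma = solve-∀
    G-this : ∀ r → suc x ℕ.< 3 ℕ.* r → G x r ≡ 0ℤ
    G-this (suc s) 1+x<3r = G-zero x s (ℕ.s<s⁻¹ (subst (suc x ℕ.<_) (arith s) 1+x<3r))
      where
      arith : ∀ s → 3 ℕ.* suc s ≡ suc (2 ℕ.+ 3 ℕ.* s)
      arith = ℕ-Solver.solve-∀

  -- This is the recurrence of the central binomial coefficients. The number of terms is the same
  -- for x and x + 1, so that the certificate can be summed; the bound on x kills the last boundary
  -- term `G x (suc l)`, and the first one is 0 by definition.
  recurrence : ∀ l x → 1 ℕ.≤ x → suc x ℕ.< 3 ℕ.* suc l →
    + suc x * ∑ (suc l) (F (suc x)) ≡ (+ 4 * + x + + 2) * ∑ (suc l) (F x)
  recurrence l x 1≤x 1+x<3L = *-cancelˡ-≡ (+ 3) _ _ (begin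
    + 3 * (+ suc x * s′)
      ≡⟨ lemma (+ suc x) s′ ((+ 4 * + x + + 2) * (+ 3 * s)) ⟩
    + 3 * + suc x * s′ - (+ 4 * + x + + 2) * (+ 3 * s) + (+ 4 * + x + + 2) * (+ 3 * s)
      ≡⟨ cong (_+ (+ 4 * + x + + 2) * (+ 3 * s)) difference ⟩
    0ℤ + (+ 4 * + x + + 2) * (+ 3 * s)
      ≡⟨ lemma′ (+ 4 * + x + + 2) s ⟩
    + 3 * ((+ 4 * + x + + 2) * s) ∎)
    where
    open ≡-Reasoning
    s s′ : ℤ
    s  = ∑ (suc l) (F x)
    s′ = ∑ (suc l) (F (suc x))
    lemma : ∀ a s z → + 3 * (a * s) ≡ + 3 * a * s - z + z
    lemma = solve-∀
    lemma′ : ∀ a s → 0ℤ + a * (+ 3 * s) ≡ + 3 * (a * s)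
    lemma′ = solve-∀
    arith : ∀ l → 3 ℕ.* suc l ≡ suc (2 ℕ.+ 3 ℕ.* l)
    arith = ℕ-Solver.solve-∀
    difference : + 3 * + suc x * s′ - (+ 4 * + x + + 2) * (+ 3 * s) ≡ 0ℤ
    difference = begin
      + 3 * + suc x * s′ - (+ 4 * + x + + 2) * (+ 3 * s)
        ≡⟨ cong (λ u → + 3 * + suc x * s′ - (+ 4 * + x + + 2) * u) (∑-*ˡ (+ 3) (suc l) (F x)) ⟩
      + 3 * + suc x * s′ - (+ 4 * + x + + 2) * ∑ (suc l) (λ r → + 3 * F x r)
        ≡⟨ ∑-linear (+ 3 * + suc x) (+ 4 * + x + + 2) (suc l) (F (suc x)) (λ r → + 3 * F x r) ⟨
      ∑ (suc l) (λ r → + 3 * + suc x * F (suc x) r - (+ 4 * + x + + 2) * (+ 3 * F x r))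
        ≡⟨ ∑-cong (suc l) (λ r _ → certificate x r 1≤x) ⟩
      ∑ (suc l) (λ r → G x r - G x (suc r))
        ≡⟨ ∑-telescope (suc l) (G x) ⟩
      0ℤ - G x (suc l)
        ≡⟨ cong (λ z → 0ℤ - z) (G-zero x l (ℕ.s<s⁻¹ (subst (suc x ℕ.<_) (arith l) 1+x<3L))) ⟩
      0ℤ ∎

  -- Induction along `recurrence`, with the argument shifted by one: the sum is 3 at argument 1,
  -- whereas at argument 0 it is 1 and the formula would ask for 3/2.
  closed-form : ∀ l x → suc x ℕ.< 3 ℕ.* suc l →
    + 2 * ∑ (suc l) (F (suc x)) * (fac (suc x) * fac (suc x)) ≡ + 3 * fac (suc x ℕ.+ suc x)
  closed-form l zero 1<3L = cong (λ s → + 2 * s * 1ℤ) {y = + 3} (begin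
    ∑ (1 ℕ.+ l) (F 1)
      ≡⟨ ∑-+ 1 l (F 1) ⟩
    0ℤ + (+ 3) ^ 1 * 1ℤ + ∑ l (λ i → F 1 (suc i))
      ≡⟨ cong (_+_ (0ℤ + (+ 3) ^ 1 * 1ℤ)) (∑-zero l λ i _ → F-zero 1 (suc i) (1<3+3i i)) ⟩
    + 3 ∎)
    where
    open ≡-Reasoning
    1<3+3i : ∀ i → 1 ℕ.< 3 ℕ.* suc i
    1<3+3i i = ℕ.≤-trans (ℕ.s≤s (ℕ.s≤s ℕ.z≤n)) (ℕ.*-monoʳ-≤ 3 (ℕ.s≤s (ℕ.z≤n {i})))
  closed-form l x@(suc x-1) 2+x<3L = begin
    + 2 * s′ * (fac (suc x) * fac (suc x))
      ≡⟨ cong (λ f → + 2 * s′ * (f * f)) (fac-suc x) ⟩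
    + 2 * s′ * (+ suc x * fac x * (+ suc x * fac x))
      ≡⟨ lemma₁ s′ (+ suc x) (fac x) ⟩
    + 2 * (+ suc x * s′) * (+ suc x * (fac x * fac x))
      ≡⟨ cong (λ u → + 2 * u * (+ suc x * (fac x * fac x))) (recurrence l x (ℕ.s≤s ℕ.z≤n) 2+x<3L) ⟩
    + 2 * ((+ 4 * + x + + 2) * s) * (+ suc x * (fac x * fac x))
      ≡⟨ lemma₂ (+ 4 * + x + + 2) s (+ suc x) (fac x) ⟩
    (+ 4 * + x + + 2) * + suc x * (+ 2 * s * (fac x * fac x))
      ≡⟨ cong ((+ 4 * + x + + 2) * + suc x *_) (closed-form l x-1 (ℕ.<⇒≤ 2+x<3L)) ⟩
    (+ 4 * + x + + 2) * + suc x * (+ 3 * fac (x ℕ.+ x))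
      ≡⟨ lemma₃ (+ x) (fac (x ℕ.+ x)) ⟩
    + 3 * ((1ℤ + (1ℤ + (+ x + + x))) * ((1ℤ + (+ x + + x)) * fac (x ℕ.+ x)))
      ≡⟨ cong (λ f → + 3 * (+ suc (suc (x ℕ.+ x)) * f)) (fac-suc (x ℕ.+ x)) ⟨
    + 3 * (+ suc (suc (x ℕ.+ x)) * fac (suc (x ℕ.+ x)))
      ≡⟨ cong (+ 3 *_) (fac-suc (suc (x ℕ.+ x))) ⟨
    + 3 * fac (suc (suc (x ℕ.+ x)))
      ≡⟨ cong (λ n → + 3 * fac (suc n)) (ℕ.+-suc x x) ⟨
    + 3 * fac (suc x ℕ.+ suc x) ∎
    where
    open ≡-Reasoning
    s s′ : ℤ
    s  = ∑ (suc l) (F x)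
    s′ = ∑ (suc l) (F (suc x))
    lemma₁ : ∀ s n f → + 2 * s * (n * f * (n * f)) ≡ + 2 * (n * s) * (n * (f * f))
    lemma₁ = solve-∀
    lemma₂ : ∀ a s n f → + 2 * (a * s) * (n * (f * f)) ≡ a * n * (+ 2 * s * (f * f))
    lemma₂ = solve-∀
    lemma₃ : ∀ x f → (+ 4 * x + + 2) * (1ℤ + x) * (+ 3 * f) ≡
             + 3 * ((1ℤ + (1ℤ + (x + x))) * ((1ℤ + (x + x)) * f))
    lemma₃ = solve-∀

  ∑F : ∀ L x → 1 ℕ.≤ x → x ℕ.< 3 ℕ.* L →
    + 2 * ∑ L (F x) * (fac x * fac x) ≡ + 3 * fac (x ℕ.+ x)
  ∑F (suc l) (suc x) _ 1+x<3L = closed-form l x 1+x<3L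

-- Quadratic functions modulo p³

-- Stands for "polynomial, known up to degree 2". The cofactor `rest` may be any integer function:
-- at multiples of P its term is divisible by P³ whatever it is, so no type of polynomials is
-- required.
record Taylor₂ (f : ℤ → ℤ) : Set where
  field
    a b c  : ℤ
    rest   : ℤ → ℤ
    expand : ∀ y → f y ≡ a + b * y + c * (y * y) + rest y * (y * (y * y))

taylor-const : ∀ k → Taylor₂ (λ _ → k)
taylor-const k = record { a = k ; b = 0ℤ ; c = 0ℤ ; rest = λ _ → 0ℤ ; expand = lemma k }
  where
  lemma : ∀ k y → k ≡ k + 0ℤ * y + 0ℤ * (y * y) + 0ℤ * (y * (y * y))
  lemma = solve-∀

taylor-shift : ∀ k → Taylor₂ (λ y → y + k)
taylor-shift k = record { a = k ; b = 1ℤ ; c = 0ℤ ; rest = λ _ → 0ℤ ; expand = lemma k }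
  where
  lemma : ∀ k y → y + k ≡ k + 1ℤ * y + 0ℤ * (y * y) + 0ℤ * (y * (y * y))
  lemma = solve-∀

taylor-+ : ∀ {f g} → Taylor₂ f → Taylor₂ g → Taylor₂ (λ y → f y + g y)
taylor-+ F G = record
  { a = F.a + G.a ; b = F.b + G.b ; c = F.c + G.c ; rest = λ y → F.rest y + G.rest y
  ; expand = λ y → trans (cong₂ _+_ (F.expand y) (G.expand y))
                         (lemma F.a F.b F.c (F.rest y) G.a G.b G.c (G.rest y) y)
  }
  where
  module F = Taylor₂ F
  module G = Taylor₂ G
  lemma : ∀ a b c d a′ b′ c′ d′ y →
    (a + b * y + c * (y * y) + d * (y * (y * y))) + (a′ + b′ * y + c′ * (y * y) + d′ * (y * (y * y))) ≡
    (a + a′) + (b + b′) * y + (c + c′) * (y * y) + (d + d′) * (y * (y * y))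
  lemma = solve-∀

taylor-* : ∀ {f g} → Taylor₂ f → Taylor₂ g → Taylor₂ (λ y → f y * g y)
taylor-* F G = record
  { a = F.a * G.a
  ; b = F.a * G.b + F.b * G.a
  ; c = F.a * G.c + F.b * G.b + F.c * G.a
  ; rest = λ y → rest F.a F.b F.c (F.rest y) G.a G.b G.c (G.rest y) y
  ; expand = λ y → trans (cong₂ _*_ (F.expand y) (G.expand y))
                         (lemma F.a F.b F.c (F.rest y) G.a G.b G.c (G.rest y) y)
  }
  where
  module F = Taylor₂ F
  module G = Taylor₂ G
  rest : ℤ → ℤ → ℤ → ℤ → ℤ → ℤ → ℤ → ℤ → ℤ → ℤ
  rest a b c d a′ b′ c′ d′ y =
    a * d′ + b * c′ + c * b′ + d * a′ + (b * d′ + c * c′ + d * b′ + (c * d′ + d * c′ + d * d′ * y) * y) * y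
  lemma : ∀ a b c d a′ b′ c′ d′ y →
    (a + b * y + c * (y * y) + d * (y * (y * y))) * (a′ + b′ * y + c′ * (y * y) + d′ * (y * (y * y))) ≡
    a * a′ + (a * b′ + b * a′) * y + (a * c′ + b * b′ + c * a′) * (y * y) +
    (a * d′ + b * c′ + c * b′ + d * a′ + (b * d′ + c * c′ + d * b′ + (c * d′ + d * c′ + d * d′ * y) * y) * y)
      * (y * (y * y))
  lemma = solve-∀

taylor-∏ : ∀ n {f : ℕ → ℤ → ℤ} → (∀ i → Taylor₂ (f i)) → Taylor₂ (λ y → ∏ n (λ i → f i y))
taylor-∏ zero    Tf = taylor-const 1ℤ
taylor-∏ (suc n) Tf = taylor-* (taylor-∏ n Tf) (Tf n)

taylor-∑ : ∀ n {f : ℕ → ℤ → ℤ} → (∀ i → Taylor₂ (f i)) → Taylor₂ (λ y → ∑ n (λ i → f i y))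
taylor-∑ zero    Tf = taylor-const 0ℤ
taylor-∑ (suc n) Tf = taylor-+ (taylor-∑ n Tf) (Tf n)

taylor-≈ : ∀ {f} → Taylor₂ f → ∀ P → f P ≈ f 0ℤ ⟨mod P ⟩
taylor-≈ F P = by (F.b + F.c * P + F.rest P * (P * P)) $
  trans (F.expand P) (trans (lemma F.a F.b F.c (F.rest P) (F.rest 0ℤ) P)
    (cong (_+ (F.b + F.c * P + F.rest P * (P * P)) * P) (sym (F.expand 0ℤ))))
  where
  module F = Taylor₂ F
  lemma : ∀ a b c d d₀ P → a + b * P + c * (P * P) + d * (P * (P * P)) ≡
    (a + b * 0ℤ + c * (0ℤ * 0ℤ) + d₀ * (0ℤ * (0ℤ * 0ℤ))) + (b + c * P + d * (P * P)) * P
  lemma = solve-∀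

-- The third difference of a quadratic function is zero, and each cubic remainder, taken at a
-- multiple of P, carries the factor P³.
third-difference : ∀ {f} → Taylor₂ f → ∀ P k →
  f (P * (+ 3 + k)) ≈ + 3 * f (P * (+ 2 + k)) - + 3 * f (P * (1ℤ + k)) + f (P * k) ⟨mod P ^ 3 ⟩
third-difference {f} F P k = by n
  (subst₂ (λ u v → u ≡ v + n * P ^ 3) (sym (F.expand (P * y₃)))
    (sym (cong₂ _+_ (cong₂ (λ u v → + 3 * u - + 3 * v) (F.expand (P * y₂)) (F.expand (P * y₁))) (F.expand (P * k))))
    (lemma F.a F.b F.c q₀ q₁ q₂ q₃ P k))
  where
  module F = Taylor₂ F
  y₁ = 1ℤ + k
  y₂ = + 2 + k
  y₃ = + 3 + k
  q₀ = F.rest (P * k)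
  q₁ = F.rest (P * y₁)
  q₂ = F.rest (P * y₂)
  q₃ = F.rest (P * y₃)
  n = q₃ * (y₃ * (y₃ * y₃)) - + 3 * (q₂ * (y₂ * (y₂ * y₂))) + + 3 * (q₁ * (y₁ * (y₁ * y₁))) - q₀ * (k * (k * k))
  lemma : ∀ a b c q₀ q₁ q₂ q₃ P k →
    a + b * (P * (+ 3 + k)) + c * (P * (+ 3 + k) * (P * (+ 3 + k)))
      + q₃ * (P * (+ 3 + k) * (P * (+ 3 + k) * (P * (+ 3 + k)))) ≡
    + 3 * (a + b * (P * (+ 2 + k)) + c * (P * (+ 2 + k) * (P * (+ 2 + k)))
      + q₂ * (P * (+ 2 + k) * (P * (+ 2 + k) * (P * (+ 2 + k)))))
    - + 3 * (a + b * (P * (1ℤ + k)) + c * (P * (1ℤ + k) * (P * (1ℤ + k)))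
      + q₁ * (P * (1ℤ + k) * (P * (1ℤ + k) * (P * (1ℤ + k)))))
    + (a + b * (P * k) + c * (P * k * (P * k)) + q₀ * (P * k * (P * k * (P * k))))
    + (q₃ * ((+ 3 + k) * ((+ 3 + k) * (+ 3 + k))) - + 3 * (q₂ * ((+ 2 + k) * ((+ 2 + k) * (+ 2 + k))))
       + + 3 * (q₁ * ((1ℤ + k) * ((1ℤ + k) * (1ℤ + k)))) - q₀ * (k * (k * k))) * (P * (P * (P * 1ℤ)))
  lemma = solve-∀

-- A geometric progression with ratio ≡ 1 (mod P) is also quadratic modulo P³.
quadratic≈geometric : ∀ {f} → Taylor₂ f → ∀ P d u → u ≈ 1ℤ ⟨mod P ⟩ →
  f 0ℤ ≈ d ⟨mod P ^ 3 ⟩ → f P ≈ d * u ⟨mod P ^ 3 ⟩ → f (P * + 2) ≈ d * u ^ 2 ⟨mod P ^ 3 ⟩ →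
  ∀ k → f (P * + k) ≈ d * u ^ k ⟨mod P ^ 3 ⟩
quadratic≈geometric {f} F P d u (by v u≡) f₀ f₁ f₂ = go
  where
  open ≈-Reasoning (P ^ 3)
  go : ∀ k → f (P * + k) ≈ d * u ^ k ⟨mod P ^ 3 ⟩
  go 0 = subst₂ (λ y z → f y ≈ z ⟨mod P ^ 3 ⟩) (sym (*-zeroʳ P)) (sym (*-identityʳ d)) f₀
  go 1 = subst₂ (λ y z → f y ≈ d * z ⟨mod P ^ 3 ⟩) (sym (*-identityʳ P)) (sym (*-identityʳ u)) f₁
  go 2 = f₂
  go (suc (suc (suc k))) = begin
    f (P * (+ 3 + + k))
      ≈⟨ third-difference F P (+ k) ⟩
    + 3 * f (P * (+ 2 + + k)) - + 3 * f (P * (1ℤ + + k)) + f (P * + k)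
      ≈⟨ +-≈ (+-≈ (*-≈ˡ (+ 3) (go (suc (suc k)))) (neg-≈ (*-≈ˡ (+ 3) (go (suc k))))) (go k) ⟩
    + 3 * (d * (u * (u * u ^ k))) - + 3 * (d * (u * u ^ k)) + d * u ^ k
      -- The third difference of d uᵏ is d uᵏ (u - 1)³, and u - 1 = v P.
      ≈⟨ ≈-sym (by (v * v * v * (d * u ^ k)) (cube u≡ d (u ^ k))) ⟩
    d * (u * (u * (u * u ^ k))) ∎
    where
    cube : ∀ {u} → u ≡ 1ℤ + v * P → ∀ d x → d * (u * (u * (u * x))) ≡
      + 3 * (d * (u * (u * x))) - + 3 * (d * (u * x)) + d * x + v * v * v * (d * x) * (P * (P * (P * 1ℤ)))
    cube refl d x = lemma v P d x
      where
      lemma : ∀ v P d x → d * ((1ℤ + v * P) * ((1ℤ + v * P) * ((1ℤ + v * P) * x))) ≡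
        + 3 * (d * ((1ℤ + v * P) * ((1ℤ + v * P) * x))) - + 3 * (d * ((1ℤ + v * P) * x)) + d * x
        + v * v * v * (d * x) * (P * (P * (P * 1ℤ)))
      lemma = solve-∀

-- Evaluation of the inner sum over r

-3ℤ : ℤ
-3ℤ = -[1+ 2 ]

module InnerSum (p : ℕ) (p-prime : Prime p) (h : ℕ) (p≡1+2h : p ≡ suc (h ℕ.+ h)) (2≤h : 2 ℕ.≤ h)
                (κ : ℤ) (-3κ≈1 : -3ℤ * κ ≈ 1ℤ ⟨mod (+ p) ^ 3 ⟩) where

  open Units p p-prime
  open Wolstenholme p p-prime h p≡1+2h 2≤h
  open WZ using (F)

  inverse-^ : ∀ n → -3ℤ ^ n * κ ^ n ≈ 1ℤ ⟨mod P ^ 3 ⟩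
  inverse-^ n = ≈-trans (≈-reflexive (sym (^-distribʳ-* n -3ℤ κ)))
                        (≈-trans (^-≈ n -3κ≈1) (≈-reflexive (^-zeroˡ n)))

  unit-neg3 : Unit -3ℤ
  unit-neg3 P∣-3 = unit-1 (≈0⇒∣ (≈-trans
    (≈-sym (≈-weaken (∣m⇒∣m*n (P * (P * 1ℤ)) (divides 1ℤ (sym (*-identityˡ P)))) -3κ≈1))
    (∣⇒≈0 (∣m⇒∣m*n κ P∣-3))))

  D : ℤ
  D = w ^ 4

  unit-D : Unit D
  unit-D = unit-^ 4 unit-w

  -- The integer that replaces 1 / r!: for r < p it is (p-1)! / r!, so that `ρ r ^ 4` is `D` / r!⁴.
  ρ : ℕ → ℤ
  ρ r = + ((h ℕ.+ h) ! ℕ./ (r !)) where instance _ = r ℕ.!≢0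

  ρ-fac : ∀ r → r ℕ.< p → ρ r * fac r ≡ w
  ρ-fac r r<p = trans (sym (pos-* ((h ℕ.+ h) ! ℕ./ (r !)) (r !)))
    (cong +_ (ℕ.m/n*n≡m (ℕ.m≤n⇒m!∣n! (ℕ.s≤s⁻¹ (subst (r ℕ.<_) p≡1+2h r<p)))))
    where instance _ = r ℕ.!≢0

  Q : ℤ → ℕ → ℤ
  Q y r = rise y r * fall y (3 ℕ.* r)

  coeff : ℕ → ℤ
  coeff r = κ ^ (3 ℕ.* r) * ρ r ^ 4

  -- `D` times the inner sum, as a function of y = p M; `κ ^ (3 * r)` plays the role of (-27)⁻ʳ.
  R : ℤ → ℤ
  R y = ∑ p (λ r → coeff r * Q y r)

  taylor-R : Taylor₂ R
  taylor-R = taylor-∑ p λ r → taylor-* (taylor-const (coeff r))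
    (taylor-* (taylor-∏ r (λ i → taylor-shift (+ suc i)))
              (taylor-∏ (3 ℕ.* r) (λ i → taylor-shift (- + i))))

  0<p : 0 ℕ.< p
  0<p = subst (0 ℕ.<_) (sym p≡1+2h) ℕ.z<s

  R-0 : R 0ℤ ≡ D
  R-0 = begin
    ∑ p g                             ≡⟨ cong (λ p → ∑ p g) p≡1+2h ⟩
    ∑ (1 ℕ.+ (h ℕ.+ h)) g             ≡⟨ ∑-+ 1 (h ℕ.+ h) g ⟩
    0ℤ + g 0 + ∑ (h ℕ.+ h) (g ∘ suc)  ≡⟨ cong (_+_ (0ℤ + g 0)) (∑-zero (h ℕ.+ h) λ i _ → g-suc i) ⟩
    0ℤ + g 0 + 0ℤ                     ≡⟨ lemma (ρ 0) ⟩
    (ρ 0 * 1ℤ) ^ 4                    ≡⟨ cong (_^ 4) (ρ-fac 0 0<p) ⟩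
    w ^ 4                             ∎
    where
    open ≡-Reasoning
    g : ℕ → ℤ
    g r = coeff r * Q 0ℤ r
    g-suc : ∀ i → g (suc i) ≡ 0ℤ
    g-suc i = trans (cong (λ f → coeff (suc i) * (rise 0ℤ (suc i) * f)) (fall-zero 0 (3 ℕ.* suc i) ℕ.z<s))
      (zero-right (coeff (suc i)) (rise 0ℤ (suc i)))
      where
      zero-right : ∀ a b → a * (b * 0ℤ) ≡ 0ℤ
      zero-right = solve-∀
    lemma : ∀ x → 0ℤ + 1ℤ * (x * (x * (x * (x * 1ℤ)))) * (1ℤ * 1ℤ) + 0ℤ ≡
            x * 1ℤ * (x * 1ℤ * (x * 1ℤ * (x * 1ℤ * 1ℤ)))
    lemma = solve-∀

  P∣P^ : ∀ k → P ∣ P ^ suc k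
  P∣P^ k = ∣m⇒∣m*n (P ^ k) (divides 1ℤ (sym (*-identityˡ P)))

  -- The factors (x+j)(x-j) ≡ -j² (mod p²) replace rise x r by (-1)ʳ r!² / fall (x-1) r.
  rise*fall≈ : ∀ x r → P ∣ 1ℤ + x → rise (1ℤ + x) r * fall x r ≈ -1ℤ ^ r * (fac r * fac r) ⟨mod P ^ 2 ⟩
  rise*fall≈ x r P∣1+x = begin
    rise (1ℤ + x) r * fall x r
      ≡⟨ ∏-* r _ _ ⟨
    ∏ r (λ j → (1ℤ + x + + suc j) * (x - + j))
      ≈⟨ ∏-≈ r (λ j _ → factor x (+ j) P∣1+x) ⟩
    ∏ r (λ j → -1ℤ * ((0ℤ + + suc j) * (0ℤ + + suc j)))
      ≡⟨ ∏-* r _ _ ⟩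
    ∏ r (λ _ → -1ℤ) * ∏ r (λ j → (0ℤ + + suc j) * (0ℤ + + suc j))
      ≡⟨ cong₂ _*_ (∏-const r -1ℤ) (∏-* r _ _) ⟩
    -1ℤ ^ r * (rise 0ℤ r * rise 0ℤ r)
      ≡⟨ cong (λ f → -1ℤ ^ r * (f * f)) (fac≡rise r) ⟩
    -1ℤ ^ r * (fac r * fac r) ∎
    where
    open ≈-Reasoning (P ^ 2)
    factor : ∀ {P} x j → P ∣ 1ℤ + x →
      (1ℤ + x + (1ℤ + j)) * (x - j) ≈ -1ℤ * ((0ℤ + (1ℤ + j)) * (0ℤ + (1ℤ + j))) ⟨mod P ^ 2 ⟩
    factor {P} x j (divides k eq) = by (k * k) (trans (lemma₁ x j)
      (trans (cong (λ u → -1ℤ * ((0ℤ + (1ℤ + j)) * (0ℤ + (1ℤ + j))) + u * u) eq) (lemma₂ j k P)))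
      where
      lemma₁ : ∀ x j → (1ℤ + x + (1ℤ + j)) * (x - j) ≡
               -1ℤ * ((0ℤ + (1ℤ + j)) * (0ℤ + (1ℤ + j))) + (1ℤ + x) * (1ℤ + x)
      lemma₁ = solve-∀
      lemma₂ : ∀ j k P → -1ℤ * ((0ℤ + (1ℤ + j)) * (0ℤ + (1ℤ + j))) + k * P * (k * P) ≡
               -1ℤ * ((0ℤ + (1ℤ + j)) * (0ℤ + (1ℤ + j))) + k * k * (P * (P * 1ℤ))
      lemma₂ = solve-∀

  -- With x = z + r + 1, both sides are x! / (x - 3r)!: the factor `fall (+ (z + r)) r` is (x-1)! /
  -- (x-r-1)! and completes the numerator x (x-r-1)! of `t` to x!.
  t-fall : ∀ e r z → e ℕ.+ 3 ℕ.* r ≡ suc (z ℕ.+ r) →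
    t (suc (z ℕ.+ r)) r * (fac r * fac r) * fall (+ (z ℕ.+ r)) r ≡ fall (+ suc (z ℕ.+ r)) (3 ℕ.* r)
  t-fall e r z eq = *-cancelʳ-≡ _ _ (fac e) {{fac-nonZero e}} (*-cancelʳ-≡ _ _ (fac z) {{fac-nonZero z}} $ begin
    t x r * (fac r * fac r) * fall (+ (z ℕ.+ r)) r * fac e * fac z
      ≡⟨ lemma₁ (t x r) (fac r) (fall (+ (z ℕ.+ r)) r) (fac e) (fac z) ⟩
    t x r * (fac e * (fac r * fac r)) * (fall (+ (z ℕ.+ r)) r * fac z)
      ≡⟨ cong₂ _*_ (t-fac e r z eq) (fall-fac z r) ⟩
    + x * fac z * fac (z ℕ.+ r)
      ≡⟨ lemma₂ (+ x) (fac z) (fac (z ℕ.+ r)) ⟩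
    + x * fac (z ℕ.+ r) * fac z
      ≡⟨ cong (_* fac z) (fac-suc (z ℕ.+ r)) ⟨
    fac x * fac z
      ≡⟨ cong (λ n → fac n * fac z) eq ⟨
    fac (e ℕ.+ 3 ℕ.* r) * fac z
      ≡⟨ cong (_* fac z) (fall-fac e (3 ℕ.* r)) ⟨
    fall (+ (e ℕ.+ 3 ℕ.* r)) (3 ℕ.* r) * fac e * fac z
      ≡⟨ cong (λ n → fall (+ n) (3 ℕ.* r) * fac e * fac z) eq ⟩
    fall (+ x) (3 ℕ.* r) * fac e * fac z ∎)
    where
    open ≡-Reasoning
    x = suc (z ℕ.+ r)
    lemma₁ : ∀ t r f e z → t * (r * r) * f * e * z ≡ t * (e * (r * r)) * (f * z)
    lemma₁ = solve-∀
    lemma₂ : ∀ x y z → x * y * z ≡ x * z * y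
    lemma₂ = solve-∀

  ∣fall : ∀ x k → x ∣ fall x (suc k)
  ∣fall x k = subst (x ∣_) (sym (∏-suc k (λ i → x - + i)))
    (∣m⇒∣m*n (∏ k (λ i → x - + suc i)) (divides 1ℤ (lemma x)))
    where
    lemma : ∀ x → x - 0ℤ ≡ 1ℤ * x
    lemma = solve-∀

  unit-fall : ∀ x r → P ∣ 1ℤ + x → r ℕ.< p → Unit (fall x r)
  unit-fall x r P∣1+x r<p = unit-∏ r λ j j<r →
    unit-≈ (factor x (+ j) P∣1+x) (unit-* {(-1ℤ)} unit-neg1 (unit-small {suc j} ℕ.z<s (ℕ.≤-<-trans j<r r<p)))
    where
    unit-neg1 : Unit -1ℤ
    unit-neg1 P∣-1 = unit-1 (∣n⇒∣m*n -1ℤ P∣-1)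
    factor : ∀ {P} x j → P ∣ 1ℤ + x → x - j ≈ -1ℤ * (1ℤ + j) ⟨mod P ⟩
    factor x j (divides k eq) = by k (trans (lemma x j) (cong (_+_ (-1ℤ * (1ℤ + j))) eq))
      where
      lemma : ∀ x j → x - j ≡ -1ℤ * (1ℤ + j) + (1ℤ + x)
      lemma = solve-∀

  -- After multiplication by the unit `fall (+ x) r`, the product `rise` * `fall` is known modulo p²
  -- by `rise*fall≈`, and the factor p of `fall (+ suc x) (3 * r)` lifts this to p³. For r = 0 that
  -- factor is missing, but there both sides are 1.
  Q≈t : ∀ x r → P ∣ + suc x → r ℕ.< p →
    Q (+ suc x) r ≈ -1ℤ ^ r * fac r ^ 4 * t (suc x) r ⟨mod P ^ 3 ⟩
  Q≈t x zero _ _ = ≈-refl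
  Q≈t x r@(suc s) P∣x r<p with 3 ℕ.* r ℕ.≤? suc x
  ... | no 3r≰x = ≈-reflexive (trans
      (cong (rise (+ suc x) r *_) (fall-zero (suc x) (3 ℕ.* r) x<3r))
      (trans (*-zeroʳ (rise (+ suc x) r)) (sym
        (trans (cong (-1ℤ ^ r * fac r ^ 4 *_) (t-zero (suc x) r x<3r)) (*-zeroʳ (-1ℤ ^ r * fac r ^ 4))))))
    where
    x<3r : suc x ℕ.< 3 ℕ.* r
    x<3r = ℕ.≰⇒> 3r≰x
  ... | yes 3r≤x = unit-cancel 3 (unit-fall (+ x) r P∣x r<p) $ begin
    fall (+ x) r * (rise (+ suc x) r * fall (+ suc x) (3 ℕ.* r))
      ≡⟨ lemma₁ (fall (+ x) r) (rise (+ suc x) r) (fall (+ suc x) (3 ℕ.* r)) ⟩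
    fall (+ suc x) (3 ℕ.* r) * (rise (+ suc x) r * fall (+ x) r)
      ≈⟨ *-≈-scale P∣fall (rise*fall≈ (+ x) r P∣x) ⟩
    fall (+ suc x) (3 ℕ.* r) * (-1ℤ ^ r * (fac r * fac r))
      ≡⟨ cong (_* (-1ℤ ^ r * (fac r * fac r))) fall≡ ⟨
    t (suc x) r * (fac r * fac r) * fall (+ x) r * (-1ℤ ^ r * (fac r * fac r))
      ≡⟨ lemma₂ (t (suc x) r) (fac r) (fall (+ x) r) (-1ℤ ^ r) ⟩
    fall (+ x) r * (-1ℤ ^ r * fac r ^ 4 * t (suc x) r) ∎
    where
    open ≈-Reasoning (P ^ 3)
    P∣fall : P ∣ fall (+ suc x) (3 ℕ.* r)
    P∣fall = subst (λ k → P ∣ fall (+ suc x) k) (sym (ℕ.*-suc 3 s))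
               (∣-trans P∣x (∣fall (+ suc x) (2 ℕ.+ 3 ℕ.* s)))
    r≤x : r ℕ.≤ x
    r≤x = ℕ.s≤s⁻¹ (3r≤1+x⇒r<x (suc x) r (ℕ.s≤s ℕ.z≤n) (ℕ.≤-trans 3r≤x (ℕ.n≤1+n (suc x))))
    fall≡ : t (suc x) r * (fac r * fac r) * fall (+ x) r ≡ fall (+ suc x) (3 ℕ.* r)
    fall≡ = subst (λ x → t (suc x) r * (fac r * fac r) * fall (+ x) r ≡ fall (+ suc x) (3 ℕ.* r))
      (ℕ.m∸n+n≡m r≤x)
      (t-fall (suc x ℕ.∸ 3 ℕ.* r) r (x ℕ.∸ r) (trans (ℕ.m∸n+n≡m 3r≤x) (cong suc (sym (ℕ.m∸n+n≡m r≤x)))))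
    lemma₁ : ∀ u r f → u * (r * f) ≡ f * (r * u)
    lemma₁ = solve-∀
    lemma₂ : ∀ t f u n → t * (f * f) * u * (n * (f * f)) ≡ u * (n * (f * (f * (f * (f * 1ℤ)))) * t)
    lemma₂ = solve-∀

  sign-split : ∀ e r → -1ℤ ^ e * -1ℤ ^ r ≡ -1ℤ ^ (e ℕ.+ 3 ℕ.* r)
  sign-split e r = trans (cong (-1ℤ ^ e *_) (^-*-assoc -1ℤ 3 r)) (sym (^-distribˡ-+-* -1ℤ e (3 ℕ.* r)))

  -- Put x = e + 3r. Then `κ ^ (3 * r)` removes (-3)³ʳ and leaves (-3)ᵉ, whose sign combines with
  -- (-1)ʳ to (-1)ˣ, as r and 3r have the same parity. So one sign, independent of r, can leave the
  -- sum.
  powers : ∀ x r →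
    -3ℤ ^ x * κ ^ (3 ℕ.* r) * (-1ℤ ^ r * t x r) ≈ -1ℤ ^ x * F x r ⟨mod P ^ 3 ⟩
  powers x r with 3 ℕ.* r ℕ.≤? x
  ... | no 3r≰x = ≈-reflexive (trans
      (cong (λ t → -3ℤ ^ x * κ ^ (3 ℕ.* r) * (-1ℤ ^ r * t)) (t-zero x r (ℕ.≰⇒> 3r≰x)))
      (trans (lemma (-3ℤ ^ x * κ ^ (3 ℕ.* r)) (-1ℤ ^ r) (-1ℤ ^ x))
        (cong (-1ℤ ^ x *_) (sym (WZ.F-zero x r (ℕ.≰⇒> 3r≰x))))))
    where
    lemma : ∀ a b c → a * (b * 0ℤ) ≡ c * 0ℤ
    lemma = solve-∀
  ... | yes 3r≤x = subst
      (λ n → -3ℤ ^ n * κ ^ (3 ℕ.* r) * (-1ℤ ^ r * t x r) ≈ -1ℤ ^ n * F x r ⟨mod P ^ 3 ⟩)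
      (ℕ.m∸n+n≡m 3r≤x) (split (x ℕ.∸ 3 ℕ.* r))
    where
    split : ∀ e → -3ℤ ^ (e ℕ.+ 3 ℕ.* r) * κ ^ (3 ℕ.* r) * (-1ℤ ^ r * t x r) ≈
                  -1ℤ ^ (e ℕ.+ 3 ℕ.* r) * ((+ 3) ^ e * t x r) ⟨mod P ^ 3 ⟩
    split e = begin
      -3ℤ ^ (e ℕ.+ 3 ℕ.* r) * κ ^ (3 ℕ.* r) * (-1ℤ ^ r * t x r)
        ≡⟨ cong (λ q → q * κ ^ (3 ℕ.* r) * (-1ℤ ^ r * t x r)) (^-distribˡ-+-* -3ℤ e (3 ℕ.* r)) ⟩
      -3ℤ ^ e * -3ℤ ^ (3 ℕ.* r) * κ ^ (3 ℕ.* r) * (-1ℤ ^ r * t x r)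
        ≡⟨ lemma₁ (-3ℤ ^ e) (-3ℤ ^ (3 ℕ.* r)) (κ ^ (3 ℕ.* r)) (-1ℤ ^ r) (t x r) ⟩
      (-3ℤ ^ (3 ℕ.* r) * κ ^ (3 ℕ.* r)) * (-3ℤ ^ e * -1ℤ ^ r * t x r)
        ≈⟨ *-≈ʳ (-3ℤ ^ e * -1ℤ ^ r * t x r) (inverse-^ (3 ℕ.* r)) ⟩
      1ℤ * (-3ℤ ^ e * -1ℤ ^ r * t x r)
        ≡⟨ cong (λ q → 1ℤ * (q * -1ℤ ^ r * t x r)) (^-distribʳ-* e -1ℤ (+ 3)) ⟩
      1ℤ * (-1ℤ ^ e * (+ 3) ^ e * -1ℤ ^ r * t x r)
        ≡⟨ lemma₂ (-1ℤ ^ e) ((+ 3) ^ e) (-1ℤ ^ r) (t x r) ⟩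
      -1ℤ ^ e * -1ℤ ^ r * ((+ 3) ^ e * t x r)
        ≡⟨ cong (_* ((+ 3) ^ e * t x r)) (sign-split e r) ⟩
      -1ℤ ^ (e ℕ.+ 3 ℕ.* r) * ((+ 3) ^ e * t x r) ∎
      where
      open ≈-Reasoning (P ^ 3)
      lemma₁ : ∀ a b c d e → a * b * c * (d * e) ≡ (b * c) * (a * d * e)
      lemma₁ = solve-∀
      lemma₂ : ∀ a b c d → 1ℤ * (a * b * c * d) ≡ a * c * (b * d)
      lemma₂ = solve-∀

  R≈∑F : ∀ x → P ∣ + suc x →
    -3ℤ ^ suc x * R (+ suc x) ≈ D * (-1ℤ ^ suc x * ∑ p (F (suc x))) ⟨mod P ^ 3 ⟩
  R≈∑F x P∣x = begin
    -3ℤ ^ suc x * R (+ suc x)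
      ≡⟨ ∑-*ˡ (-3ℤ ^ suc x) p _ ⟩
    ∑ p (λ r → -3ℤ ^ suc x * (coeff r * Q (+ suc x) r))
      ≈⟨ ∑-≈ p term ⟩
    ∑ p (λ r → D * (-1ℤ ^ suc x * F (suc x) r))
      ≡⟨ ∑-*ˡ D p (λ r → -1ℤ ^ suc x * F (suc x) r) ⟨
    D * ∑ p (λ r → -1ℤ ^ suc x * F (suc x) r)
      ≡⟨ cong (D *_) (∑-*ˡ (-1ℤ ^ suc x) p (F (suc x))) ⟨
    D * (-1ℤ ^ suc x * ∑ p (F (suc x))) ∎
    where
    open ≈-Reasoning (P ^ 3)
    term : ∀ r → r ℕ.< p → -3ℤ ^ suc x * (coeff r * Q (+ suc x) r) ≈
                           D * (-1ℤ ^ suc x * F (suc x) r) ⟨mod P ^ 3 ⟩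
    term r r<p = begin
      -3ℤ ^ suc x * (coeff r * Q (+ suc x) r)
        ≈⟨ *-≈ˡ (-3ℤ ^ suc x) (*-≈ˡ (coeff r) (Q≈t x r P∣x r<p)) ⟩
      -3ℤ ^ suc x * (coeff r * (-1ℤ ^ r * fac r ^ 4 * t (suc x) r))
        ≡⟨ lemma (-3ℤ ^ suc x) (κ ^ (3 ℕ.* r)) (ρ r) (-1ℤ ^ r) (fac r) (t (suc x) r) ⟩
      (ρ r * fac r) ^ 4 * (-3ℤ ^ suc x * κ ^ (3 ℕ.* r) * (-1ℤ ^ r * t (suc x) r))
        ≡⟨ cong (λ u → u ^ 4 * (-3ℤ ^ suc x * κ ^ (3 ℕ.* r) * (-1ℤ ^ r * t (suc x) r))) (ρ-fac r r<p) ⟩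
      D * (-3ℤ ^ suc x * κ ^ (3 ℕ.* r) * (-1ℤ ^ r * t (suc x) r))
        ≈⟨ *-≈ˡ D (powers (suc x) r) ⟩
      D * (-1ℤ ^ suc x * F (suc x) r) ∎
      where
      lemma : ∀ a k r s f t → a * (k * (r * (r * (r * (r * 1ℤ)))) * (s * (f * (f * (f * (f * 1ℤ)))) * t)) ≡
        r * f * (r * f * (r * f * (r * f * 1ℤ))) * (a * k * (s * t))
      lemma = solve-∀

  -- The closed form at x = p m relates the sum to (2pm)! / (pm)!². By `fac-p*` the powers of p
  -- cancel exactly, and what is left of the factorials is w²ᵐ on both sides modulo p³. The bound m
  -- < 3 gives p m < 3p, so that the range r < p contains all nonzero terms.
  ∑F≈ : ∀ m → 1 ℕ.≤ m → m ℕ.< 3 →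
    fac m * fac m * (+ 2 * ∑ p (F (p ℕ.* m))) ≈ + 3 * fac (m ℕ.+ m) ⟨mod P ^ 3 ⟩
  ∑F≈ m 1≤m m<3 = unit-cancel 3 (unit-* (unit-^ m unit-w) (unit-^ m unit-w)) $ begin
    w ^ m * w ^ m * (fac m * fac m * (+ 2 * s))
      ≈⟨ *-≈ʳ (fac m * fac m * (+ 2 * s)) (*-≈ (φ≈wᵃ m) (φ≈wᵃ m)) ⟨
    φ m * φ m * (fac m * fac m * (+ 2 * s))
      ≡⟨ *-cancelˡ-≡ (P ^ m * P ^ m) _ _ {{P²ᵐ-nonZero}} exact ⟩
    φ (m ℕ.+ m) * (+ 3 * fac (m ℕ.+ m))
      ≈⟨ *-≈ʳ (+ 3 * fac (m ℕ.+ m)) (≈-trans (φ≈wᵃ (m ℕ.+ m)) (≈-reflexive (^-distribˡ-+-* w m m))) ⟩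
    w ^ m * w ^ m * (+ 3 * fac (m ℕ.+ m)) ∎
    where
    open ≈-Reasoning (P ^ 3)
    s : ℤ
    s = ∑ p (F (p ℕ.* m))
    P²ᵐ-nonZero : NonZero (P ^ m * P ^ m)
    P²ᵐ-nonZero = i*j≢0 (P ^ m) (P ^ m) {{^-nonZero P m}} {{^-nonZero P m}}
    exact : P ^ m * P ^ m * (φ m * φ m * (fac m * fac m * (+ 2 * s))) ≡
            P ^ m * P ^ m * (φ (m ℕ.+ m) * (+ 3 * fac (m ℕ.+ m)))
    exact = ≡.begin
      P ^ m * P ^ m * (φ m * φ m * (fac m * fac m * (+ 2 * s)))
        ≡.≡⟨ lemma₁ (P ^ m) (φ m) (fac m) s ⟩
      + 2 * s * (P ^ m * fac m * φ m * (P ^ m * fac m * φ m))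
        ≡.≡⟨ cong (λ f → + 2 * s * (f * f)) (fac-p* m) ⟨
      + 2 * s * (fac (p ℕ.* m) * fac (p ℕ.* m))
        ≡.≡⟨ HypergeometricSum.∑F p (p ℕ.* m) (ℕ.*-mono-≤ 0<p 1≤m)
             (subst (p ℕ.* m ℕ.<_) (ℕ.*-comm p 3) (ℕ.*-monoʳ-< p {{prime⇒nonZero p-prime}} m<3)) ⟩
      + 3 * fac (p ℕ.* m ℕ.+ p ℕ.* m)
        ≡.≡⟨ cong (λ n → + 3 * fac n) (ℕ.*-distribˡ-+ p m m) ⟨
      + 3 * fac (p ℕ.* (m ℕ.+ m))
        ≡.≡⟨ cong (+ 3 *_) (fac-p* (m ℕ.+ m)) ⟩
      + 3 * (P ^ (m ℕ.+ m) * fac (m ℕ.+ m) * φ (m ℕ.+ m))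
        ≡.≡⟨ cong (λ u → + 3 * (u * fac (m ℕ.+ m) * φ (m ℕ.+ m))) (^-distribˡ-+-* P m m) ⟩
      + 3 * (P ^ m * P ^ m * fac (m ℕ.+ m) * φ (m ℕ.+ m))
        ≡.≡⟨ lemma₂ (P ^ m * P ^ m) (fac (m ℕ.+ m)) (φ (m ℕ.+ m)) ⟩
      P ^ m * P ^ m * (φ (m ℕ.+ m) * (+ 3 * fac (m ℕ.+ m))) ≡.∎
      where
      module ≡ = ≡-Reasoning
      lemma₁ : ∀ q f m s → q * q * (f * f * (m * m * (+ 2 * s))) ≡ + 2 * s * (q * m * f * (q * m * f))
      lemma₁ = solve-∀
      lemma₂ : ∀ q m f → + 3 * (q * m * f) ≡ q * (f * (+ 3 * m))
      lemma₂ = solve-∀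

  4<p : 4 ℕ.< p
  4<p = subst (4 ℕ.<_) (sym p≡1+2h) (ℕ.s≤s (ℕ.+-mono-≤ 2≤h 2≤h))

  ∑F≈3 : ∑ p (F (p ℕ.* 1)) ≈ (+ 3) ^ 1 ⟨mod P ^ 3 ⟩
  ∑F≈3 = unit-cancel 3 (unit-small {2} ℕ.z<s (ℕ.≤-trans (ℕ.m≤m+n 3 2) 4<p))
    (≈-trans (≈-reflexive (sym (*-identityˡ (+ 2 * ∑ p (F (p ℕ.* 1)))))) (∑F≈ 1 ℕ.≤-refl (ℕ.m≤m+n 2 1)))

  ∑F≈9 : ∑ p (F (p ℕ.* 2)) ≈ (+ 3) ^ 2 ⟨mod P ^ 3 ⟩
  -- For m = 2 the congruence reads 2!² · 2 · s ≡ 3 · 4!, that is 8 s ≡ 72.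
  ∑F≈9 = unit-cancel 3 (unit-* {+ 4} {+ 2} (unit-small ℕ.z<s 4<p) (unit-small {2} ℕ.z<s (ℕ.≤-trans (ℕ.m≤m+n 3 2) 4<p)))
    (≈-trans (≈-reflexive (*-assoc (+ 4) (+ 2) (∑ p (F (p ℕ.* 2))))) (∑F≈ 2 (ℕ.m≤m+n 1 1) ℕ.≤-refl))

  -1^p : -1ℤ ^ p ≡ -1ℤ
  -1^p = trans (cong (-1ℤ ^_) p≡1+2h) (cong (-1ℤ *_) (trans (^-distribˡ-+-* -1ℤ h h)
    (trans (sym (^-distribʳ-* h -1ℤ -1ℤ)) (^-zeroˡ h))))

  -- The inverse of (-3)^(p-1) modulo p³.
  u : ℤ
  u = κ ^ (h ℕ.+ h)

  -3ᵖᵐuᵐ : ∀ m → -3ℤ ^ (p ℕ.* m) * u ^ m ≈ -3ℤ ^ m ⟨mod P ^ 3 ⟩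
  -3ᵖᵐuᵐ m = begin
    -3ℤ ^ (p ℕ.* m) * u ^ m
      ≡⟨ cong (λ q → q * u ^ m) (^-*-assoc -3ℤ p m) ⟨
    (-3ℤ ^ p) ^ m * u ^ m
      ≡⟨ ^-distribʳ-* m (-3ℤ ^ p) u ⟨
    (-3ℤ ^ p * u) ^ m
      ≡⟨ cong (λ n → (-3ℤ ^ n * u) ^ m) p≡1+2h ⟩
    (-3ℤ * -3ℤ ^ (h ℕ.+ h) * κ ^ (h ℕ.+ h)) ^ m
      ≈⟨ ^-≈ m (≈-trans (≈-reflexive (*-assoc -3ℤ (-3ℤ ^ (h ℕ.+ h)) (κ ^ (h ℕ.+ h))))
           (*-≈ˡ -3ℤ (inverse-^ (h ℕ.+ h)))) ⟩
    (-3ℤ * 1ℤ) ^ m ∎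
    where open ≈-Reasoning (P ^ 3)

  R≈ : ∀ m → 1 ℕ.≤ m → ∑ p (F (p ℕ.* m)) ≈ (+ 3) ^ m ⟨mod P ^ 3 ⟩ →
       R (P * + m) ≈ D * u ^ m ⟨mod P ^ 3 ⟩
  R≈ m 1≤m ∑F≈3ᵐ = unit-cancel 3 (unit-^ (p ℕ.* m) unit-neg3) $ begin
    -3ℤ ^ (p ℕ.* m) * R (P * + m)
      ≡⟨ cong (λ x → -3ℤ ^ (p ℕ.* m) * R x) (pos-* p m) ⟨
    -3ℤ ^ (p ℕ.* m) * R (+ (p ℕ.* m))
      ≈⟨ at-positive (p ℕ.* m) (ℕ.*-mono-≤ 0<p 1≤m) (divides (+ m) (trans (pos-* p m) (*-comm P (+ m)))) ⟩
    D * (-1ℤ ^ (p ℕ.* m) * ∑ p (F (p ℕ.* m)))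
      ≈⟨ *-≈ˡ D (*-≈ˡ (-1ℤ ^ (p ℕ.* m)) ∑F≈3ᵐ) ⟩
    D * (-1ℤ ^ (p ℕ.* m) * (+ 3) ^ m)
      ≡⟨ cong (λ s → D * (s * (+ 3) ^ m)) (trans (sym (^-*-assoc -1ℤ p m)) (cong (_^ m) -1^p)) ⟩
    D * (-1ℤ ^ m * (+ 3) ^ m)
      ≡⟨ cong (D *_) (^-distribʳ-* m -1ℤ (+ 3)) ⟨
    D * -3ℤ ^ m
      ≈⟨ *-≈ˡ D (-3ᵖᵐuᵐ m) ⟨
    D * (-3ℤ ^ (p ℕ.* m) * u ^ m)
      ≡⟨ lemma D (-3ℤ ^ (p ℕ.* m)) (u ^ m) ⟩
    -3ℤ ^ (p ℕ.* m) * (D * u ^ m) ∎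
    where
    open ≈-Reasoning (P ^ 3)
    at-positive : ∀ x → 1 ℕ.≤ x → P ∣ + x → -3ℤ ^ x * R (+ x) ≈ D * (-1ℤ ^ x * ∑ p (F x)) ⟨mod P ^ 3 ⟩
    at-positive (suc x) _ = R≈∑F x
    lemma : ∀ a b c → a * (b * c) ≡ b * (a * c)
    lemma = solve-∀

  -- Fermat's little theorem for -3, read off from the sum itself: the case M = 1 gives `R P` ≡ `D`
  -- u, while modulo P only the constant term `R 0ℤ` = `D` of `R P` survives.
  u≈1 : u ≈ 1ℤ ⟨mod P ⟩
  u≈1 = unit-cancel₁ unit-D $ begin
    D * u              ≡⟨ cong (D *_) (^-identityʳ u) ⟨
    D * u ^ 1          ≈⟨ ≈-weaken (P∣P^ 2) (R≈ 1 ℕ.≤-refl ∑F≈3) ⟨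
    R (P * 1ℤ)         ≡⟨ cong R (*-identityʳ P) ⟩
    R P                ≈⟨ taylor-≈ taylor-R P ⟩
    R 0ℤ               ≡⟨ R-0 ⟩
    D                  ≡⟨ *-identityʳ D ⟨
    D * 1ℤ             ∎
    where open ≈-Reasoning P

  R≈Duᵐ : ∀ m → R (P * + m) ≈ D * u ^ m ⟨mod P ^ 3 ⟩
  R≈Duᵐ = quadratic≈geometric taylor-R P D u u≈1 (≈-reflexive R-0)
    (≈-trans (≈-reflexive (cong R (sym (*-identityʳ P))))
      (≈-trans (R≈ 1 ℕ.≤-refl ∑F≈3) (≈-reflexive (cong (D *_) (^-identityʳ u)))))
    (R≈ 2 (ℕ.m≤m+n 1 1) ∑F≈9)

  R-evaluation : ∀ m → -3ℤ ^ (p ℕ.* m) * R (P * + m) ≈ D * -3ℤ ^ m ⟨mod P ^ 3 ⟩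
  R-evaluation m = begin
    -3ℤ ^ (p ℕ.* m) * R (P * + m)        ≈⟨ *-≈ˡ (-3ℤ ^ (p ℕ.* m)) (R≈Duᵐ m) ⟩
    -3ℤ ^ (p ℕ.* m) * (D * u ^ m)        ≡⟨ lemma (-3ℤ ^ (p ℕ.* m)) D (u ^ m) ⟩
    D * (-3ℤ ^ (p ℕ.* m) * u ^ m)        ≈⟨ *-≈ˡ D (-3ᵖᵐuᵐ m) ⟩
    D * -3ℤ ^ m                          ∎
    where
    open ≈-Reasoning (P ^ 3)
    lemma : ∀ a b c → a * (b * c) ≡ b * (a * c)
    lemma = solve-∀

-- The blocks k = p m + r

W : ℕ → ℕ → ℤ
W n k = + ((3 ℕ.* k) C k) * + ((2 ℕ.* k) C k) * + (n C (3 ℕ.* k)) * + ((n ℕ.+ k) C k)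

W-fac : ∀ e k → W (e ℕ.+ 3 ℕ.* k) k * (fac e * fac k ^ 4) ≡ fac (e ℕ.+ 3 ℕ.* k ℕ.+ k)
W-fac e k = begin
  a * b * c * d * (fac e * fac k ^ 4)
    ≡⟨ lemma a b c d (fac e) (fac k) ⟩
  d * (c * (fac e * (a * (b * (fac k * fac k) * fac k))) * fac k)
    ≡⟨ cong (λ f → d * (c * (fac e * (a * (f * fac k))) * fac k)) (C-fac′ k (2 ℕ.* k) k (cong (k ℕ.+_) (ℕ.+-identityʳ k))) ⟩
  d * (c * (fac e * (a * (fac (2 ℕ.* k) * fac k))) * fac k)
    ≡⟨ cong (λ f → d * (c * (fac e * f) * fac k)) (C-fac′ (2 ℕ.* k) (3 ℕ.* k) k (ℕ.+-comm k (2 ℕ.* k))) ⟩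
  d * (c * (fac e * fac (3 ℕ.* k)) * fac k)
    ≡⟨ cong (λ f → d * (f * fac k)) (C-fac e (3 ℕ.* k)) ⟩
  d * (fac (e ℕ.+ 3 ℕ.* k) * fac k)
    ≡⟨ C-fac (e ℕ.+ 3 ℕ.* k) k ⟩
  fac (e ℕ.+ 3 ℕ.* k ℕ.+ k) ∎
  where
  open ≡-Reasoning
  a = + ((3 ℕ.* k) C k)
  b = + ((2 ℕ.* k) C k)
  c = + ((e ℕ.+ 3 ℕ.* k) C (3 ℕ.* k))
  d = + ((e ℕ.+ 3 ℕ.* k ℕ.+ k) C k)
  C-fac′ : ∀ a n b → n ≡ a ℕ.+ b → + (n C b) * (fac a * fac b) ≡ fac n
  C-fac′ a n b refl = C-fac a b
  lemma : ∀ a b c d e f → a * b * c * d * (e * (f * (f * (f * (f * 1ℤ))))) ≡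
          d * (c * (e * (a * (b * (f * f) * f))) * f)
  lemma = solve-∀

W-zero : ∀ n k → n ℕ.< 3 ℕ.* k → W n k ≡ 0ℤ
W-zero n k n<3k = trans (cong (λ c → a * + c * d) (k>n⇒nCk≡0 n<3k)) (lemma a d)
  where
  a = + ((3 ℕ.* k) C k) * + ((2 ℕ.* k) C k)
  d = + ((n ℕ.+ k) C k)
  lemma : ∀ a d → a * 0ℤ * d ≡ 0ℤ
  lemma = solve-∀

term-split : ∀ n k → a₀-term n k ≡ -1ℤ ^ (n ℕ.∸ k) * (+ 3) ^ (n ℕ.∸ 3 ℕ.* k) * W n k
term-split n k = lemma (-1ℤ ^ (n ℕ.∸ k)) (+ ((3 ℕ.* k) C k)) (+ ((2 ℕ.* k) C k))
  (+ (n C (3 ℕ.* k))) (+ ((n ℕ.+ k) C k)) ((+ 3) ^ (n ℕ.∸ 3 ℕ.* k))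
  where
  lemma : ∀ s a b c d q → s * a * b * c * d * q ≡ s * q * (a * b * c * d)
  lemma = solve-∀

-- With e = n - 3k, the exponents n - k and e differ by the even number 2k, so sign and power of 3
-- merge into (-3)ᵉ.
term≡ : ∀ e k → a₀-term (e ℕ.+ 3 ℕ.* k) k ≡ -3ℤ ^ e * W (e ℕ.+ 3 ℕ.* k) k
term≡ e k = begin
  a₀-term n k
    ≡⟨ term-split n k ⟩
  -1ℤ ^ (n ℕ.∸ k) * (+ 3) ^ (n ℕ.∸ 3 ℕ.* k) * W n k
    ≡⟨ cong₂ (λ i j → -1ℤ ^ i * (+ 3) ^ j * W n k)
         (trans (cong (ℕ._∸ k) (arith e k)) (ℕ.m+n∸n≡m (e ℕ.+ 2 ℕ.* k) k)) (ℕ.m+n∸n≡m e (3 ℕ.* k)) ⟩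
  -1ℤ ^ (e ℕ.+ 2 ℕ.* k) * (+ 3) ^ e * W n k
    ≡⟨ cong (λ s → s * (+ 3) ^ e * W n k) sign ⟩
  -1ℤ ^ e * (+ 3) ^ e * W n k
    ≡⟨ cong (_* W n k) (^-distribʳ-* e -1ℤ (+ 3)) ⟨
  -3ℤ ^ e * W n k ∎
  where
  open ≡-Reasoning
  n = e ℕ.+ 3 ℕ.* k
  arith : ∀ e k → e ℕ.+ 3 ℕ.* k ≡ e ℕ.+ 2 ℕ.* k ℕ.+ k
  arith = ℕ-Solver.solve-∀
  sign : -1ℤ ^ (e ℕ.+ 2 ℕ.* k) ≡ -1ℤ ^ e
  sign = trans (^-distribˡ-+-* -1ℤ e (2 ℕ.* k))
    (trans (cong (-1ℤ ^ e *_) (trans (sym (^-*-assoc -1ℤ 2 k)) (^-zeroˡ k))) (*-identityʳ (-1ℤ ^ e)))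

term-zero : ∀ n k → n ℕ.< 3 ℕ.* k → a₀-term n k ≡ 0ℤ
term-zero n k n<3k = trans (term-split n k)
  (trans (cong (c *_) (W-zero n k n<3k)) (*-zeroʳ c))
  where
  c = -1ℤ ^ (n ℕ.∸ k) * (+ 3) ^ (n ℕ.∸ 3 ℕ.* k)

module Block (p : ℕ) (p-prime : Prime p) (h : ℕ) (p≡1+2h : p ≡ suc (h ℕ.+ h)) (2≤h : 2 ℕ.≤ h)
             (κ : ℤ) (-3κ≈1 : -3ℤ * κ ≈ 1ℤ ⟨mod (+ p) ^ 3 ⟩) (M m : ℕ) where

  open Units p p-prime
  open Wolstenholme p p-prime h p≡1+2h 2≤h
  open InnerSum p p-prime h p≡1+2h 2≤h κ -3κ≈1

  n : ℕ
  n = M ℕ.+ 3 ℕ.* m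

  V : ℕ → ℤ
  V r = W (p ℕ.* n) (p ℕ.* m ℕ.+ r)

  V₀ : ℤ
  V₀ = W (p ℕ.* n) (p ℕ.* m)

  pn≡ : p ℕ.* n ≡ p ℕ.* M ℕ.+ 3 ℕ.* (p ℕ.* m)
  pn≡ = lemma p M m
    where
    lemma : ∀ p M m → p ℕ.* (M ℕ.+ 3 ℕ.* m) ≡ p ℕ.* M ℕ.+ 3 ℕ.* (p ℕ.* m)
    lemma = ℕ-Solver.solve-∀

  pn≡′ : ∀ e r → e ℕ.+ 3 ℕ.* r ≡ p ℕ.* M → p ℕ.* n ≡ e ℕ.+ 3 ℕ.* (p ℕ.* m ℕ.+ r)
  pn≡′ e r eq = trans pn≡ (trans (cong (ℕ._+ 3 ℕ.* (p ℕ.* m)) (sym eq)) (lemma e (p ℕ.* m) r))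
    where
    lemma : ∀ e k r → e ℕ.+ 3 ℕ.* r ℕ.+ 3 ℕ.* k ≡ e ℕ.+ 3 ℕ.* (k ℕ.+ r)
    lemma = ℕ-Solver.solve-∀

  pn<3k : ∀ r → p ℕ.* M ℕ.< 3 ℕ.* r → p ℕ.* n ℕ.< 3 ℕ.* (p ℕ.* m ℕ.+ r)
  pn<3k r pM<3r = subst₂ ℕ._<_ (sym pn≡) (lemma (p ℕ.* m) r) (ℕ.+-monoˡ-< (3 ℕ.* (p ℕ.* m)) pM<3r)
    where
    lemma : ∀ k r → 3 ℕ.* r ℕ.+ 3 ℕ.* k ≡ 3 ℕ.* (k ℕ.+ r)
    lemma = ℕ-Solver.solve-∀

  V₀-fac : V₀ * (fac (p ℕ.* M) * fac (p ℕ.* m) ^ 4) ≡ fac (p ℕ.* (n ℕ.+ m))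
  V₀-fac = subst₂ (λ x y → W x (p ℕ.* m) * (fac (p ℕ.* M) * fac (p ℕ.* m) ^ 4) ≡ fac y)
    (sym pn≡) (trans (cong (ℕ._+ p ℕ.* m) (sym pn≡)) (sym (ℕ.*-distribˡ-+ p n m)))
    (W-fac (p ℕ.* M) (p ℕ.* m))

  -- The exact ratio `V r` / `V₀`, with denominators cleared: passing from p m to p m + r multiplies
  -- (p n + p m)! by a `rise`, divides (p M)! in the denominator by a `fall`, and multiplies each of
  -- the four (p m)! by a `rise`. If 3r > p M, both sides are zero.
  V-rise : ∀ r → rise (+ (p ℕ.* m)) r ^ 4 * V r ≡
                 V₀ * (rise (+ (p ℕ.* (n ℕ.+ m))) r * fall (+ (p ℕ.* M)) (3 ℕ.* r))
  V-rise r with 3 ℕ.* r ℕ.≤? p ℕ.* M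
  ... | no 3r≰pM = trans
      (trans (cong (rise (+ (p ℕ.* m)) r ^ 4 *_) (W-zero (p ℕ.* n) (p ℕ.* m ℕ.+ r) (pn<3k r (ℕ.≰⇒> 3r≰pM))))
             (lemma (rise (+ (p ℕ.* m)) r ^ 4) V₀ (rise (+ (p ℕ.* (n ℕ.+ m))) r)))
      (cong (λ f → V₀ * (rise (+ (p ℕ.* (n ℕ.+ m))) r * f)) (sym (fall-zero (p ℕ.* M) (3 ℕ.* r) (ℕ.≰⇒> 3r≰pM))))
    where
    lemma : ∀ a b c → a * 0ℤ ≡ b * (c * 0ℤ)
    lemma = solve-∀
  ... | yes 3r≤pM = exact (p ℕ.* M ℕ.∸ 3 ℕ.* r) (ℕ.m∸n+n≡m 3r≤pM)
    where
    exact : ∀ e → e ℕ.+ 3 ℕ.* r ≡ p ℕ.* M → rise (+ (p ℕ.* m)) r ^ 4 * V r ≡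
            V₀ * (rise (+ (p ℕ.* (n ℕ.+ m))) r * fall (+ (p ℕ.* M)) (3 ℕ.* r))
    exact e eq = *-cancelˡ-≡ (fac e * fac (p ℕ.* m) ^ 4) _ _
      {{i*j≢0 (fac e) (fac (p ℕ.* m) ^ 4) {{fac-nonZero e}} {{^-nonZero (fac (p ℕ.* m)) 4 {{fac-nonZero (p ℕ.* m)}}}}}} $ begin
      fac e * fac (p ℕ.* m) ^ 4 * (rise (+ (p ℕ.* m)) r ^ 4 * V r)
        ≡⟨ lemma₁ (fac e) (fac (p ℕ.* m)) (rise (+ (p ℕ.* m)) r) (V r) ⟩
      V r * (fac e * (rise (+ (p ℕ.* m)) r * fac (p ℕ.* m)) ^ 4)
        ≡⟨ cong (λ f → V r * (fac e * f ^ 4)) (rise-fac (p ℕ.* m) r) ⟩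
      V r * (fac e * fac (p ℕ.* m ℕ.+ r) ^ 4)
        ≡⟨ subst (λ x → W x (p ℕ.* m ℕ.+ r) * (fac e * fac (p ℕ.* m ℕ.+ r) ^ 4) ≡ fac (x ℕ.+ (p ℕ.* m ℕ.+ r)))
             (sym (pn≡′ e r eq)) (W-fac e (p ℕ.* m ℕ.+ r)) ⟩
      fac (p ℕ.* n ℕ.+ (p ℕ.* m ℕ.+ r))
        ≡⟨ cong fac (trans (sym (ℕ.+-assoc (p ℕ.* n) (p ℕ.* m) r)) (cong (ℕ._+ r) (sym (ℕ.*-distribˡ-+ p n m)))) ⟩
      fac (p ℕ.* (n ℕ.+ m) ℕ.+ r)
        ≡⟨ rise-fac (p ℕ.* (n ℕ.+ m)) r ⟨
      rise (+ (p ℕ.* (n ℕ.+ m))) r * fac (p ℕ.* (n ℕ.+ m))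
        ≡⟨ cong (rise (+ (p ℕ.* (n ℕ.+ m))) r *_) V₀-fac ⟨
      rise (+ (p ℕ.* (n ℕ.+ m))) r * (V₀ * (fac (p ℕ.* M) * fac (p ℕ.* m) ^ 4))
        ≡⟨ cong (λ f → rise (+ (p ℕ.* (n ℕ.+ m))) r * (V₀ * (f * fac (p ℕ.* m) ^ 4)))
             (subst (λ x → fall (+ x) (3 ℕ.* r) * fac e ≡ fac x) eq (fall-fac e (3 ℕ.* r))) ⟨
      rise (+ (p ℕ.* (n ℕ.+ m))) r * (V₀ * (fall (+ (p ℕ.* M)) (3 ℕ.* r) * fac e * fac (p ℕ.* m) ^ 4))
        ≡⟨ lemma₂ (rise (+ (p ℕ.* (n ℕ.+ m))) r) V₀ (fall (+ (p ℕ.* M)) (3 ℕ.* r)) (fac e) (fac (p ℕ.* m) ^ 4) ⟩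
      fac e * fac (p ℕ.* m) ^ 4 * (V₀ * (rise (+ (p ℕ.* (n ℕ.+ m))) r * fall (+ (p ℕ.* M)) (3 ℕ.* r))) ∎
      where
      open ≡-Reasoning
      lemma₁ : ∀ e f r v → e * (f * (f * (f * (f * 1ℤ)))) * (r * (r * (r * (r * 1ℤ))) * v) ≡
               v * (e * (r * f * (r * f * (r * f * (r * f * 1ℤ)))))
      lemma₁ = solve-∀
      lemma₂ : ∀ r v u e f → r * (v * (u * e * f)) ≡ e * f * (v * (r * u))
      lemma₂ = solve-∀

  -- Because n + m = M + 4m, numerator and denominator contain the same power of p and, modulo p³,
  -- the same power of w.
  V₀≈W : V₀ ≈ W n m ⟨mod P ^ 3 ⟩
  V₀≈W = unit-cancel 3 (unit-* (unit-^ M unit-w) (unit-^ 4 (unit-^ m unit-w))) $ begin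
    w ^ M * (w ^ m) ^ 4 * V₀
      ≈⟨ *-≈ʳ V₀ (*-≈ (φ≈wᵃ M) (^-≈ 4 (φ≈wᵃ m))) ⟨
    φ M * φ m ^ 4 * V₀
      ≡⟨ *-cancelˡ-≡ (q * (fac M * fac m ^ 4)) _ _ {{nonZero}} exact ⟩
    φ (n ℕ.+ m) * W n m
      ≈⟨ *-≈ʳ (W n m) (φ≈wᵃ (n ℕ.+ m)) ⟩
    w ^ (n ℕ.+ m) * W n m
      ≡⟨ cong (_* W n m) (power w) ⟩
    w ^ M * (w ^ m) ^ 4 * W n m ∎
    where
    open ≈-Reasoning (P ^ 3)
    q : ℤ
    q = P ^ M * (P ^ m) ^ 4
    nonZero : NonZero (q * (fac M * fac m ^ 4))
    nonZero = i*j≢0 q (fac M * fac m ^ 4)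
      {{i*j≢0 (P ^ M) ((P ^ m) ^ 4) {{^-nonZero P M}} {{^-nonZero (P ^ m) 4 {{^-nonZero P m}}}}}}
      {{i*j≢0 (fac M) (fac m ^ 4) {{fac-nonZero M}} {{^-nonZero (fac m) 4 {{fac-nonZero m}}}}}}
    power : ∀ x → x ^ (n ℕ.+ m) ≡ x ^ M * (x ^ m) ^ 4
    power x = trans (cong (x ^_) (arith M m))
      (trans (^-distribˡ-+-* x M (m ℕ.* 4)) (cong (x ^ M *_) (sym (^-*-assoc x m 4))))
      where
      arith : ∀ M m → M ℕ.+ 3 ℕ.* m ℕ.+ m ≡ M ℕ.+ m ℕ.* 4
      arith = ℕ-Solver.solve-∀
    exact : q * (fac M * fac m ^ 4) * (φ M * φ m ^ 4 * V₀) ≡ q * (fac M * fac m ^ 4) * (φ (n ℕ.+ m) * W n m)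
    exact = ≡.begin
      q * (fac M * fac m ^ 4) * (φ M * φ m ^ 4 * V₀)
        ≡.≡⟨ lemma₁ (P ^ M) (P ^ m) (fac M) (fac m) (φ M) (φ m) V₀ ⟩
      V₀ * (P ^ M * fac M * φ M * (P ^ m * fac m * φ m) ^ 4)
        ≡.≡⟨ cong₂ (λ x y → V₀ * (x * y ^ 4)) (fac-p* M) (fac-p* m) ⟨
      V₀ * (fac (p ℕ.* M) * fac (p ℕ.* m) ^ 4)
        ≡.≡⟨ V₀-fac ⟩
      fac (p ℕ.* (n ℕ.+ m))
        ≡.≡⟨ fac-p* (n ℕ.+ m) ⟩
      P ^ (n ℕ.+ m) * fac (n ℕ.+ m) * φ (n ℕ.+ m)
        ≡.≡⟨ cong₂ (λ x y → x * y * φ (n ℕ.+ m)) (power P) (sym (W-fac M m)) ⟩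
      q * (W n m * (fac M * fac m ^ 4)) * φ (n ℕ.+ m)
        ≡.≡⟨ lemma₂ q (W n m) (fac M * fac m ^ 4) (φ (n ℕ.+ m)) ⟩
      q * (fac M * fac m ^ 4) * (φ (n ℕ.+ m) * W n m) ≡.∎
      where
      module ≡ = ≡-Reasoning
      lemma₁ : ∀ a b f g x y v →
        a * (b * (b * (b * (b * 1ℤ)))) * (f * (g * (g * (g * (g * 1ℤ))))) * (x * (y * (y * (y * (y * 1ℤ)))) * v) ≡
        v * (a * f * x * (b * g * y * (b * g * y * (b * g * y * (b * g * y * 1ℤ)))))
      lemma₁ = solve-∀
      lemma₂ : ∀ q v f x → q * (v * f) * x ≡ q * f * (x * v)
      lemma₂ = solve-∀

  -- This is where m drops out. Since n + m = M + 4m, the factors compare (p M + 4 p m + j) j⁴ with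
  -- (p M + j)(p m + j)⁴; both have the linear part p (M + 4m) j⁴, because the coefficient 4 matches
  -- the exponent 4 of k! in `W`. The difference consists of terms with p².
  rises≈ : ∀ r → rise (+ (p ℕ.* (n ℕ.+ m))) r * fac r ^ 4 ≈
                 rise (+ (p ℕ.* M)) r * rise (+ (p ℕ.* m)) r ^ 4 ⟨mod P ^ 2 ⟩
  rises≈ r = subst₂
    (λ x f → rise x r * f ^ 4 ≈ rise (+ (p ℕ.* M)) r * rise (+ (p ℕ.* m)) r ^ 4 ⟨mod P ^ 2 ⟩)
    (sym pN≡) (fac≡rise r)
    (subst₂ (λ x y → rise (x + + 4 * y) r * rise 0ℤ r ^ 4 ≈ rise x r * rise y r ^ 4 ⟨mod P ^ 2 ⟩)
      (sym (pos-* p M)) (sym (pos-* p m)) (go P (+ M) (+ m) r))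
    where
    pN≡ : + (p ℕ.* (n ℕ.+ m)) ≡ + (p ℕ.* M) + + 4 * + (p ℕ.* m)
    pN≡ = trans (cong +_ (arith p M m)) (cong (_+_ (+ (p ℕ.* M))) (pos-* 4 (p ℕ.* m)))
      where
      arith : ∀ p M m → p ℕ.* (M ℕ.+ 3 ℕ.* m ℕ.+ m) ≡ p ℕ.* M ℕ.+ 4 ℕ.* (p ℕ.* m)
      arith = ℕ-Solver.solve-∀
    factor : ∀ P M m j → (P * M + + 4 * (P * m) + j) * (0ℤ + j) ^ 4 ≈ (P * M + j) * (P * m + j) ^ 4 ⟨mod P ^ 2 ⟩
    factor P M m j = by
      (- (+ 4 * m * M * (j * j * j) + (P * M + j) * (+ 6 * m * m * j * j + + 4 * P * m * m * m * j + P * P * m * m * m * m)))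
      (lemma P M m j)
      where
      lemma : ∀ P M m j →
        (P * M + + 4 * (P * m) + j) * ((0ℤ + j) * ((0ℤ + j) * ((0ℤ + j) * ((0ℤ + j) * 1ℤ)))) ≡
        (P * M + j) * ((P * m + j) * ((P * m + j) * ((P * m + j) * ((P * m + j) * 1ℤ)))) +
        - (+ 4 * m * M * (j * j * j) + (P * M + j) * (+ 6 * m * m * j * j + + 4 * P * m * m * m * j + P * P * m * m * m * m))
          * (P * (P * 1ℤ))
      lemma = solve-∀
    pull : ∀ a b x y → a * x * (b * y) ^ 4 ≡ a * b ^ 4 * (x * y ^ 4)
    pull = lemma
      where
      lemma : ∀ a b x y → a * x * (b * y * (b * y * (b * y * (b * y * 1ℤ)))) ≡
              a * (b * (b * (b * (b * 1ℤ)))) * (x * (y * (y * (y * (y * 1ℤ)))))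
      lemma = solve-∀
    go : ∀ P M m r → rise (P * M + + 4 * (P * m)) r * rise 0ℤ r ^ 4 ≈
                     rise (P * M) r * rise (P * m) r ^ 4 ⟨mod P ^ 2 ⟩
    go P M m zero    = ≈-refl
    go P M m (suc r) = begin
      rise (P * M + + 4 * (P * m)) (suc r) * rise 0ℤ (suc r) ^ 4
        ≡⟨ pull (rise (P * M + + 4 * (P * m)) r) (rise 0ℤ r) (P * M + + 4 * (P * m) + + suc r) (0ℤ + + suc r) ⟩
      rise (P * M + + 4 * (P * m)) r * rise 0ℤ r ^ 4 * ((P * M + + 4 * (P * m) + + suc r) * (0ℤ + + suc r) ^ 4)
        ≈⟨ *-≈ (go P M m r) (factor P M m (+ suc r)) ⟩
      rise (P * M) r * rise (P * m) r ^ 4 * ((P * M + + suc r) * (P * m + + suc r) ^ 4)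
        ≡⟨ pull (rise (P * M) r) (rise (P * m) r) (P * M + + suc r) (P * m + + suc r) ⟨
      rise (P * M) (suc r) * rise (P * m) (suc r) ^ 4 ∎
      where open ≈-Reasoning (P ^ 2)

  unit-rise : ∀ r → r ℕ.< p → Unit (rise (+ (p ℕ.* m)) r)
  unit-rise r r<p = unit-∏ r λ j j<r →
    unit-≈ (by (+ m) (trans (+-comm (+ (p ℕ.* m)) (+ suc j))
                            (cong (_+_ (+ suc j)) (trans (pos-* p m) (*-comm P (+ m))))))
           (unit-small {suc j} ℕ.z<s (ℕ.≤-<-trans j<r r<p))

  P∣pM : P ∣ + (p ℕ.* M)
  P∣pM = divides (+ M) (trans (pos-* p M) (*-comm P (+ M)))

  -- The factor p M of the falling factorial lifts rises≈ from p² to p³.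
  V≈Q : ∀ r → r ℕ.< p → fac r ^ 4 * V r ≈ V₀ * Q (+ (p ℕ.* M)) r ⟨mod P ^ 3 ⟩
  V≈Q zero    _   = ≈-reflexive (trans
    (cong (λ k → 1ℤ * W (p ℕ.* n) k) (ℕ.+-identityʳ (p ℕ.* m))) (lemma V₀))
    where
    lemma : ∀ v → 1ℤ * v ≡ v * (1ℤ * 1ℤ)
    lemma = solve-∀
  V≈Q r@(suc s) r<p = unit-cancel 3 (unit-^ 4 (unit-rise r r<p)) $ begin
    rise (+ (p ℕ.* m)) r ^ 4 * (fac r ^ 4 * V r)
      ≡⟨ lemma₁ (rise (+ (p ℕ.* m)) r ^ 4) (fac r ^ 4) (V r) ⟩
    fac r ^ 4 * (rise (+ (p ℕ.* m)) r ^ 4 * V r)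
      ≡⟨ cong (fac r ^ 4 *_) (V-rise r) ⟩
    fac r ^ 4 * (V₀ * (rise (+ (p ℕ.* (n ℕ.+ m))) r * fall (+ (p ℕ.* M)) (3 ℕ.* r)))
      ≡⟨ lemma₂ (fac r ^ 4) V₀ (rise (+ (p ℕ.* (n ℕ.+ m))) r) (fall (+ (p ℕ.* M)) (3 ℕ.* r)) ⟩
    V₀ * (fall (+ (p ℕ.* M)) (3 ℕ.* r) * (rise (+ (p ℕ.* (n ℕ.+ m))) r * fac r ^ 4))
      ≈⟨ *-≈ˡ V₀ (*-≈-scale P∣fall (rises≈ r)) ⟩
    V₀ * (fall (+ (p ℕ.* M)) (3 ℕ.* r) * (rise (+ (p ℕ.* M)) r * rise (+ (p ℕ.* m)) r ^ 4))
      ≡⟨ lemma₃ V₀ (fall (+ (p ℕ.* M)) (3 ℕ.* r)) (rise (+ (p ℕ.* M)) r) (rise (+ (p ℕ.* m)) r ^ 4) ⟩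
    rise (+ (p ℕ.* m)) r ^ 4 * (V₀ * Q (+ (p ℕ.* M)) r) ∎
    where
    open ≈-Reasoning (P ^ 3)
    P∣fall : P ∣ fall (+ (p ℕ.* M)) (3 ℕ.* r)
    P∣fall = subst (λ k → P ∣ fall (+ (p ℕ.* M)) k) (sym (ℕ.*-suc 3 s))
               (∣-trans P∣pM (∣fall (+ (p ℕ.* M)) (2 ℕ.+ 3 ℕ.* s)))
    lemma₁ : ∀ a b c → a * (b * c) ≡ b * (a * c)
    lemma₁ = solve-∀
    lemma₂ : ∀ a v r f → a * (v * (r * f)) ≡ v * (f * (r * a))
    lemma₂ = solve-∀
    lemma₃ : ∀ v f r a → v * (f * (r * a)) ≡ a * (v * (r * f))
    lemma₃ = solve-∀

  term≈-zero : ∀ r → p ℕ.* M ℕ.< 3 ℕ.* r →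
    a₀-term (p ℕ.* n) (p ℕ.* m ℕ.+ r) ≈ -3ℤ ^ (p ℕ.* M) * (κ ^ (3 ℕ.* r) * V r) ⟨mod P ^ 3 ⟩
  term≈-zero r pM<3r = begin
    a₀-term (p ℕ.* n) (p ℕ.* m ℕ.+ r)                ≡⟨ term-zero (p ℕ.* n) (p ℕ.* m ℕ.+ r) (pn<3k r pM<3r) ⟩
    0ℤ                                               ≡⟨ lemma (-3ℤ ^ (p ℕ.* M)) (κ ^ (3 ℕ.* r)) ⟩
    -3ℤ ^ (p ℕ.* M) * (κ ^ (3 ℕ.* r) * 0ℤ)           ≡⟨ cong (λ v → -3ℤ ^ (p ℕ.* M) * (κ ^ (3 ℕ.* r) * v))
                                                          (W-zero (p ℕ.* n) (p ℕ.* m ℕ.+ r) (pn<3k r pM<3r)) ⟨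
    -3ℤ ^ (p ℕ.* M) * (κ ^ (3 ℕ.* r) * V r)          ∎
    where
    open ≈-Reasoning (P ^ 3)
    lemma : ∀ a b → 0ℤ ≡ a * (b * 0ℤ)
    lemma = solve-∀

  term≈-split : ∀ r e → e ℕ.+ 3 ℕ.* r ≡ p ℕ.* M → a₀-term (p ℕ.* n) (p ℕ.* m ℕ.+ r) ≈
       -3ℤ ^ (p ℕ.* M) * (κ ^ (3 ℕ.* r) * V r) ⟨mod P ^ 3 ⟩
  term≈-split r e eq = begin
    a₀-term (p ℕ.* n) (p ℕ.* m ℕ.+ r)
      ≡⟨ subst (λ x → a₀-term x (p ℕ.* m ℕ.+ r) ≡ -3ℤ ^ e * W x (p ℕ.* m ℕ.+ r))
           (sym (pn≡′ e r eq)) (term≡ e (p ℕ.* m ℕ.+ r)) ⟩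
    -3ℤ ^ e * V r
      ≡⟨ *-identityˡ (-3ℤ ^ e * V r) ⟨
    1ℤ * (-3ℤ ^ e * V r)
      ≈⟨ *-≈ʳ (-3ℤ ^ e * V r) (inverse-^ (3 ℕ.* r)) ⟨
    -3ℤ ^ (3 ℕ.* r) * κ ^ (3 ℕ.* r) * (-3ℤ ^ e * V r)
      ≡⟨ lemma (-3ℤ ^ (3 ℕ.* r)) (κ ^ (3 ℕ.* r)) (-3ℤ ^ e) (V r) ⟩
    -3ℤ ^ e * -3ℤ ^ (3 ℕ.* r) * (κ ^ (3 ℕ.* r) * V r)
      ≡⟨ cong (_* (κ ^ (3 ℕ.* r) * V r)) (^-distribˡ-+-* -3ℤ e (3 ℕ.* r)) ⟨
    -3ℤ ^ (e ℕ.+ 3 ℕ.* r) * (κ ^ (3 ℕ.* r) * V r)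
      ≡⟨ cong (λ x → -3ℤ ^ x * (κ ^ (3 ℕ.* r) * V r)) eq ⟩
    -3ℤ ^ (p ℕ.* M) * (κ ^ (3 ℕ.* r) * V r) ∎
    where
    open ≈-Reasoning (P ^ 3)
    lemma : ∀ a b c d → a * b * (c * d) ≡ c * a * (b * d)
    lemma = solve-∀

  -- Replacing (-3)^(p M - 3r) by (-3)^(p M) `κ ^ (3 * r)` separates M from r. The formula stays
  -- valid for 3r > p M, where the exponent would be negative, because `V r` is zero there.
  term≈ : ∀ r → a₀-term (p ℕ.* n) (p ℕ.* m ℕ.+ r) ≈ -3ℤ ^ (p ℕ.* M) * (κ ^ (3 ℕ.* r) * V r) ⟨mod P ^ 3 ⟩
  term≈ r = Sum.[ (λ 3r≤pM → term≈-split r (p ℕ.* M ℕ.∸ 3 ℕ.* r) (ℕ.m∸n+n≡m 3r≤pM)) , term≈-zero r ]′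
              (ℕ.≤-<-connex (3 ℕ.* r) (p ℕ.* M))

  D-term≈ : ∀ r → r ℕ.< p → D * a₀-term (p ℕ.* n) (p ℕ.* m ℕ.+ r) ≈
            -3ℤ ^ (p ℕ.* M) * V₀ * (coeff r * Q (+ (p ℕ.* M)) r) ⟨mod P ^ 3 ⟩
  D-term≈ r r<p = begin
    D * a₀-term (p ℕ.* n) (p ℕ.* m ℕ.+ r)
      ≈⟨ *-≈ˡ D (term≈ r) ⟩
    D * (-3ℤ ^ (p ℕ.* M) * (κ ^ (3 ℕ.* r) * V r))
      ≡⟨ cong (λ u → u ^ 4 * (-3ℤ ^ (p ℕ.* M) * (κ ^ (3 ℕ.* r) * V r))) (ρ-fac r r<p) ⟨
    (ρ r * fac r) ^ 4 * (-3ℤ ^ (p ℕ.* M) * (κ ^ (3 ℕ.* r) * V r))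
      ≡⟨ lemma₁ (ρ r) (fac r) (-3ℤ ^ (p ℕ.* M)) (κ ^ (3 ℕ.* r)) (V r) ⟩
    -3ℤ ^ (p ℕ.* M) * (coeff r * (fac r ^ 4 * V r))
      ≈⟨ *-≈ˡ (-3ℤ ^ (p ℕ.* M)) (*-≈ˡ (coeff r) (V≈Q r r<p)) ⟩
    -3ℤ ^ (p ℕ.* M) * (coeff r * (V₀ * Q (+ (p ℕ.* M)) r))
      ≡⟨ lemma₂ (-3ℤ ^ (p ℕ.* M)) (coeff r) V₀ (Q (+ (p ℕ.* M)) r) ⟩
    -3ℤ ^ (p ℕ.* M) * V₀ * (coeff r * Q (+ (p ℕ.* M)) r) ∎
    where
    open ≈-Reasoning (P ^ 3)
    lemma₁ : ∀ r f a k v →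
      r * f * (r * f * (r * f * (r * f * 1ℤ))) * (a * (k * v)) ≡
      a * (k * (r * (r * (r * (r * 1ℤ)))) * (f * (f * (f * (f * 1ℤ))) * v))
    lemma₁ = solve-∀
    lemma₂ : ∀ a c v q → a * (c * (v * q)) ≡ a * v * (c * q)
    lemma₂ = solve-∀

  -- The block splits into `V₀`, which carries m, and `R` at p M, which does not. `V₀≈W` and
  -- `R-evaluation` turn the product into `D` (-3)ᴹ `W n m`, which is `D` times the term of a₀ n at
  -- m.
  block≈ : ∑ p (λ r → a₀-term (p ℕ.* n) (p ℕ.* m ℕ.+ r)) ≈ a₀-term n m ⟨mod P ^ 3 ⟩
  block≈ = unit-cancel 3 unit-D $ begin
    D * ∑ p (λ r → a₀-term (p ℕ.* n) (p ℕ.* m ℕ.+ r))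
      ≡⟨ ∑-*ˡ D p _ ⟩
    ∑ p (λ r → D * a₀-term (p ℕ.* n) (p ℕ.* m ℕ.+ r))
      ≈⟨ ∑-≈ p D-term≈ ⟩
    ∑ p (λ r → -3ℤ ^ (p ℕ.* M) * V₀ * (coeff r * Q (+ (p ℕ.* M)) r))
      ≡⟨ ∑-*ˡ (-3ℤ ^ (p ℕ.* M) * V₀) p (λ r → coeff r * Q (+ (p ℕ.* M)) r) ⟨
    -3ℤ ^ (p ℕ.* M) * V₀ * R (+ (p ℕ.* M))
      ≡⟨ cong (λ x → -3ℤ ^ (p ℕ.* M) * V₀ * R x) (pos-* p M) ⟩
    -3ℤ ^ (p ℕ.* M) * V₀ * R (P * + M)
      ≡⟨ lemma₁ (-3ℤ ^ (p ℕ.* M)) V₀ (R (P * + M)) ⟩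
    V₀ * (-3ℤ ^ (p ℕ.* M) * R (P * + M))
      ≈⟨ *-≈ V₀≈W (R-evaluation M) ⟩
    W n m * (D * -3ℤ ^ M)
      ≡⟨ lemma₂ (W n m) D (-3ℤ ^ M) ⟩
    D * (-3ℤ ^ M * W n m)
      ≡⟨ cong (D *_) (term≡ M m) ⟨
    D * a₀-term n m ∎
    where
    open ≈-Reasoning (P ^ 3)
    lemma₁ : ∀ a v r → a * v * r ≡ v * (a * r)
    lemma₁ = solve-∀
    lemma₂ : ∀ w d q → w * (d * q) ≡ d * (q * w)
    lemma₂ = solve-∀

-- Inverting -3 modulo p³ and assembling the blocks

lift-inverse : ∀ a v {m} → a * v ≈ 1ℤ ⟨mod m ⟩ → ∃[ b ] a * b ≈ 1ℤ ⟨mod m ^ 3 ⟩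
lift-inverse a v {m} (by q av≡) = v * s , by (q * q * q)
  (trans (sym (*-assoc a v s)) (trans (cong (_* s) av≡) (lemma q m)))
  where
  -- The geometric series of 1 / (1 + q m), cut after the square: (1 + x)(1 - x + x²) = 1 + x³ with
  -- x = q m.
  s : ℤ
  s = 1ℤ - q * m + q * m * (q * m)
  lemma : ∀ q m → (1ℤ + q * m) * (1ℤ - q * m + q * m * (q * m)) ≡ 1ℤ + q * q * q * (m * (m * (m * 1ℤ)))
  lemma = solve-∀

-3-inverse : ∀ p → Prime p → 3 ℕ.< p → ∃[ κ ] -3ℤ * κ ≈ 1ℤ ⟨mod (+ p) ^ 3 ⟩
-3-inverse p p-prime 3<p = from-Bézout (coprime-Bézout (prime⇒coprime p-prime 3<p))
  where
  from-Bézout : Bézout.Identity 1 p 3 → ∃[ κ ] -3ℤ * κ ≈ 1ℤ ⟨mod (+ p) ^ 3 ⟩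
  -- Here 1 + 3y = x p, so y itself inverts -3 modulo p; in the other case 1 + x p = 3y, and -y
  -- does.
  from-Bézout (Bézout.+- x y eq) = lift-inverse -3ℤ (+ y) (by (- + x) (trans (lemma₁ (+ y)) (trans
    (cong (λ z → 1ℤ - z) (trans (cong (_+_ 1ℤ) (sym (pos-* y 3))) (trans (cong +_ eq) (pos-* x p))))
    (lemma₂ (+ x) (+ p)))))
    where
    lemma₁ : ∀ y → -3ℤ * y ≡ 1ℤ - (1ℤ + y * + 3)
    lemma₁ = solve-∀
    lemma₂ : ∀ x p → 1ℤ - x * p ≡ 1ℤ + - x * p
    lemma₂ = solve-∀
  from-Bézout (Bézout.-+ x y eq) = lift-inverse -3ℤ (- + y) (by (+ x) (trans (lemma (+ y)) (trans
    (sym (pos-* y 3)) (trans (cong +_ (sym eq)) (cong (_+_ 1ℤ) (pos-* x p))))))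
    where
    lemma : ∀ y → -3ℤ * - y ≡ y * + 3
    lemma = solve-∀

parity : ∀ n → ∃[ h ] (n ≡ h ℕ.+ h ⊎ n ≡ suc (h ℕ.+ h))
parity zero = 0 , inj₁ refl
parity (suc n) = next (parity n)
  where
  next : ∃[ h ] (n ≡ h ℕ.+ h ⊎ n ≡ suc (h ℕ.+ h)) → ∃[ h ] (suc n ≡ h ℕ.+ h ⊎ suc n ≡ suc (h ℕ.+ h))
  next (h , inj₁ n≡2h)   = h , inj₂ (cong suc n≡2h)
  next (h , inj₂ n≡1+2h) = suc h , inj₁ (cong suc (trans n≡1+2h (sym (ℕ.+-suc h h))))

prime-odd : ∀ p → Prime p → 2 ℕ.< p → ∃[ h ] p ≡ suc (h ℕ.+ h)
prime-odd p p-prime 2<p = from-parity (parity p)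
  where
  from-parity : ∃[ h ] (p ≡ h ℕ.+ h ⊎ p ≡ suc (h ℕ.+ h)) → ∃[ h ] p ≡ suc (h ℕ.+ h)
  from-parity (h , inj₂ p≡1+2h) = h , p≡1+2h
  from-parity (h , inj₁ p≡2h) with prime⇒irreducible p-prime {2} (ℕ.divides h (trans p≡2h (lemma h)))
    where
    lemma : ∀ h → h ℕ.+ h ≡ h ℕ.* 2
    lemma = ℕ-Solver.solve-∀
  ... | inj₂ 2≡p = contradiction 2≡p (ℕ.<⇒≢ 2<p)

sum-upto≡∑ : ∀ m f → sum-upto m f ≡ ∑ (suc m) f
sum-upto≡∑ zero    f = sym (+-identityˡ (f 0))
sum-upto≡∑ (suc m) f = cong (_+ f (suc m)) (sum-upto≡∑ m f)

∑-extend : ∀ {m n} f → m ℕ.≤ n → (∀ i → m ℕ.≤ i → f i ≡ 0ℤ) → ∑ m f ≡ ∑ n f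
∑-extend {m} {n} f m≤n f≡0 = begin
  ∑ m f                                         ≡⟨ +-identityʳ (∑ m f) ⟨
  ∑ m f + 0ℤ                                    ≡⟨ cong (_+_ (∑ m f)) (∑-zero (n ℕ.∸ m) λ i _ → f≡0 (m ℕ.+ i) (ℕ.m≤m+n m i)) ⟨
  ∑ m f + ∑ (n ℕ.∸ m) (λ i → f (m ℕ.+ i))       ≡⟨ ∑-+ m (n ℕ.∸ m) f ⟨
  ∑ (m ℕ.+ (n ℕ.∸ m)) f                         ≡⟨ cong (λ k → ∑ k f) (ℕ.m+[n∸m]≡n m≤n) ⟩
  ∑ n f                                         ∎
  where open ≡-Reasoning

n<3[1+n/3] : ∀ n → n ℕ.< 3 ℕ.* suc (n ℕ./ 3)
n<3[1+n/3] n = subst₂ ℕ._<_ (sym (ℕ.m≡m%n+[m/n]*n n 3)) (ℕ.*-comm (suc (n ℕ./ 3)) 3)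
  (ℕ.+-monoˡ-< (n ℕ./ 3 ℕ.* 3) (ℕ.m%n<n n 3))

supercongruence : ∀ p → Prime p → 5 ℕ.≤ p → ∀ n → a₀ (p ℕ.* n) ≈ a₀ n ⟨mod (+ p) ^ 3 ⟩
supercongruence p p-prime 5≤p n
  with prime-odd p p-prime (ℕ.≤-trans (ℕ.m≤m+n 3 2) 5≤p) | -3-inverse p p-prime (ℕ.≤-trans (ℕ.m≤m+n 4 1) 5≤p)
... | h , p≡1+2h | κ , -3κ≈1 = begin
  a₀ (p ℕ.* n)
    ≡⟨ sum-upto≡∑ (p ℕ.* n ℕ./ 3) (a₀-term (p ℕ.* n)) ⟩
  ∑ (suc (p ℕ.* n ℕ./ 3)) (a₀-term (p ℕ.* n))
    -- Padding with zero terms makes the range a whole number of blocks, one for each term of a₀ n.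
    ≡⟨ ∑-extend (a₀-term (p ℕ.* n)) range≤ beyond ⟩
  ∑ (p ℕ.* suc (n ℕ./ 3)) (a₀-term (p ℕ.* n))
    ≡⟨ ∑-blocks p (suc (n ℕ./ 3)) (a₀-term (p ℕ.* n)) ⟩
  ∑ (suc (n ℕ./ 3)) (λ m → ∑ p (λ r → a₀-term (p ℕ.* n) (p ℕ.* m ℕ.+ r)))
    ≈⟨ ∑-≈ (suc (n ℕ./ 3)) block≈ ⟩
  ∑ (suc (n ℕ./ 3)) (a₀-term n)
    ≡⟨ sum-upto≡∑ (n ℕ./ 3) (a₀-term n) ⟨
  a₀ n ∎
  where
  open ≈-Reasoning ((+ p) ^ 3)
  range≤ : p ℕ.* n ℕ./ 3 ℕ.< p ℕ.* suc (n ℕ./ 3)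
  range≤ = ℕ.m<n*o⇒m/o<n (subst (p ℕ.* n ℕ.<_) (lemma p (suc (n ℕ./ 3)))
    (ℕ.*-monoʳ-< p {{prime⇒nonZero p-prime}} (n<3[1+n/3] n)))
    where
    lemma : ∀ p q → p ℕ.* (3 ℕ.* q) ≡ p ℕ.* q ℕ.* 3
    lemma = ℕ-Solver.solve-∀
  beyond : ∀ k → p ℕ.* n ℕ./ 3 ℕ.< k → a₀-term (p ℕ.* n) k ≡ 0ℤ
  beyond k pn/3<k = term-zero (p ℕ.* n) k
    (ℕ.<-≤-trans (n<3[1+n/3] (p ℕ.* n)) (ℕ.*-monoʳ-≤ 3 pn/3<k))
  2≤half : ∀ h → 5 ℕ.≤ suc (h ℕ.+ h) → 2 ℕ.≤ h
  2≤half (suc zero)    (ℕ.s≤s (ℕ.s≤s (ℕ.s≤s ())))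
  2≤half (suc (suc h)) _ = ℕ.s≤s (ℕ.s≤s ℕ.z≤n)
  block≈ : ∀ m → m ℕ.< suc (n ℕ./ 3) →
    ∑ p (λ r → a₀-term (p ℕ.* n) (p ℕ.* m ℕ.+ r)) ≈ a₀-term n m ⟨mod (+ p) ^ 3 ⟩
  block≈ m m≤n/3 = subst
    (λ n → ∑ p (λ r → a₀-term (p ℕ.* n) (p ℕ.* m ℕ.+ r)) ≈ a₀-term n m ⟨mod (+ p) ^ 3 ⟩)
    (ℕ.m∸n+n≡m 3m≤n)
    (Block.block≈ p p-prime h p≡1+2h (2≤half h (subst (5 ℕ.≤_) p≡1+2h 5≤p)) κ -3κ≈1 (n ℕ.∸ 3 ℕ.* m) m)
    where
    3m≤n : 3 ℕ.* m ℕ.≤ n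
    3m≤n = ℕ.≤-trans (ℕ.*-monoʳ-≤ 3 (ℕ.s≤s⁻¹ m≤n/3))
             (subst (ℕ._≤ n) (ℕ.*-comm (n ℕ./ 3) 3) (ℕ.m/n*n≤m n 3))

mainTheorem1 : (p : ℕ) → Prime p → 5 ℕ.≤ p → (n : ℕ) → 1 ℕ.≤ n → a₀ (p ℕ.* n) ≡ a₀ n [mod + (p ℕ.^ 3) ]
mainTheorem1 p p-prime 5≤p n _ =
  ≈⇒∣ (subst (a₀ (p ℕ.* n) ≈ a₀ n ⟨mod_⟩) (sym p³≡) (supercongruence p p-prime 5≤p n))
  where
  p³≡ : + (p ℕ.^ 3) ≡ (+ p) ^ 3
  p³≡ = trans (pos-* p _) (cong (+ p *_) (trans (pos-* p _) (cong (+ p *_) (pos-* p 1))))
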